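{- Let $a$, $b$, $c$ be pairwise coprime positive integers with $a+c$ even. Then for all integers $p,q\geq1$ and all $x,y,z\in\mathbb{R}$, \begin{align*} a^{1-p}b^{1-q}S^{(3,5)}_{p,q}(a,b,c:x,y,z) &=-\frac{q}{2}\sum_{j=1}^{p}\binom{p-1}{j-1}a^{1-j}c^{1+j-p-q}S^{(4)}_{p+q-j,j}(c,-a,b:z,x,y)\\ &\quad+\sum_{h=0}^{q}\binom{q}{h}(-1)^{h}b^{1-h}c^{1+h-p-q}S^{(3,5)}_{p+q-h,h}(c,b,a:z,-y,x). \end{align*}
   Context: $B_n(x)$ is the $n$th Bernoulli polynomial ($\frac{te^{xt}}{e^t-1}=\sum B_n(x)\frac{t^n}{n!}$) and $\mathcal{B}_n(x)=B_n(x-[x])$ the $n$th Bernoulli function ($[x]$ the largest integer $\le x$; $\mathcal{B}_0\equiv1$). $E_n(x)$ is the $n$th Euler polynomial ($\frac{2e^{xt}}{e^t+1}=\sum E_n(x)\frac{t^n}{n!}$), and the Euler function $\mathcal{E}_n$ ($n\ge0$) is defined by $\mathcal{E}_n(x)=E_n(x)$ for $0\le x<1$ and $\mathcal{E}_n(x+m)=(-1)^m\mathcal{E}_n(x)$ for $m\in\mathbb{Z}$. For integers $a,b$, a positive integer $c$ and real $x,y,z$ define, for integers $p\ge1$, $q\ge0$, $$S^{(3,5)}_{p,q}(a,b,c:x,y,z)=\sum_{\mu=0}^{c-1}(-1)^{\mu}\mathcal{E}_{p-1}\Big(a\frac{\mu+z}{c}+x\Big)\mathcal{B}_{q}\Big(b\frac{\mu+z}{c}+y\Big),$$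 and, for integers $p,q\ge1$, $$S^{(4)}_{p,q}(a,b,c:x,y,z)=\sum_{\mu=0}^{c-1}\mathcal{E}_{p-1}\Big(a\frac{\mu+z}{c}+x\Big)\mathcal{E}_{q-1}\Big(b\frac{\mu+z}{c}+y\Big).$$ -}

module Defs where

open import Algebra.Bundles using (CommutativeRing)
import Algebra.Properties.Ring as RingProperties
import Algebra.Properties.Semiring.Exp as SemiringExp
import Algebra.Properties.Semiring.Mult as SemiringMult
import Algebra.Properties.Semiring.Sum as SemiringSum
open import Data.Fin.Base using (Fin; zero; suc; toℕ)
open import Data.Integer.Base as ℤ using (ℤ; +_; -[1+_]; 0ℤ)
import Data.Integer.Properties as ℤ
open import Data.Nat.Base as ℕ using (ℕ; zero; suc; _∸_; _!)
import Data.Nat.Properties as ℕ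
open import Data.Product.Base using (∃; _×_; _,_)
open import Data.Sum.Base using (inj₁; inj₂)
open import Data.Vec.Base using (Vec; []; _∷_; lookup)
open import Level using (_⊔_) renaming (suc to lsuc)
open import Relation.Binary.PropositionalEquality.Core as ≡ using (_≡_)
import Relation.Binary.Reasoning.Setoid as SetoidReasoning
open import Relation.Binary.Structures using (IsDecTotalOrder)
open import Relation.Nullary.Negation using (¬_)

module IntegerEmbedding {c ℓ} (R : CommutativeRing c ℓ) where
  open CommutativeRing R
  open SemiringMult semiring using () renaming (_×_ to _·ℕ_)

  fromℕ : ℕ → Carrier
  fromℕ n = n ·ℕ 1#

  fromℤ : ℤ → Carrier
  fromℤ (+ n)    = fromℕ n
  fromℤ -[1+ n ] = - fromℕ (suc n)

-- The real numbers, axiomatised as a Dedekind-complete ordered field.  The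
-- decidable order and the floor function exist for the classical reals, but
-- they do not follow constructively from the other axioms and so are fields.
-- The value of 0# ⁻¹ is left open.
record RealField c ℓ₁ ℓ₂ : Set (lsuc (c ⊔ ℓ₁ ⊔ ℓ₂)) where
  field
    commutativeRing : CommutativeRing c ℓ₁

  open CommutativeRing commutativeRing public
  open IntegerEmbedding commutativeRing public

  infix  9 _⁻¹
  infix  4 _≤_

  field
    _⁻¹         : Carrier → Carrier
    ⁻¹-cong     : ∀ {x y} → x ≈ y → x ⁻¹ ≈ y ⁻¹
    ⁻¹-inverseʳ : ∀ {x} → ¬ (x ≈ 0#) → x * x ⁻¹ ≈ 1#
    1≉0         : ¬ (1# ≈ 0#)

    _≤_             : Carrier → Carrier → Set ℓ₂
    isDecTotalOrder : IsDecTotalOrder _≈_ _≤_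
    +-monoˡ-≤       : ∀ z {x y} → x ≤ y → x + z ≤ y + z
    *-nonNegative   : ∀ {x y} → 0# ≤ x → 0# ≤ y → 0# ≤ x * y

    ⌊_⌋             : Carrier → ℤ
    ⌊⌋-lowerBound   : ∀ x → fromℤ ⌊ x ⌋ ≤ x
    ⌊⌋-greatest     : ∀ x m → fromℤ m ≤ x → m ℤ.≤ ⌊ x ⌋

    supremum : (P : Carrier → Set (c ⊔ ℓ₁ ⊔ ℓ₂)) →
               ∃ P → (∃ λ b → ∀ x → P x → x ≤ b) →
               ∃ λ s → (∀ x → P x → x ≤ s) ×
                       (∀ b → (∀ x → P x → x ≤ b) → s ≤ b)

module Dedekind {c ℓ₁ ℓ₂} (ℝ : RealField c ℓ₁ ℓ₂) where

  open RealField ℝ public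
  open SemiringExp semiring public using (_^_)
  open SemiringSum semiring using (sum)

  infixl 7 _/_
  infixr 8 _^ℤ_

  _/_ : Carrier → Carrier → Carrier
  x / y = x * y ⁻¹

  _^ℤ_ : Carrier → ℤ → Carrier
  x ^ℤ (+ n)    = x ^ n
  x ^ℤ -[1+ n ] = (x ⁻¹) ^ suc n

  -- ∑[ m ⋯ n ] f = f m + f (m + 1) + … + f n, empty when n < m.
  ∑[_⋯_] : ℕ → ℕ → (ℕ → Carrier) → Carrier
  ∑[ m ⋯ n ] f = sum {suc n ∸ m} λ i → f (m ℕ.+ toℕ i)

  -- Formal power series in t, as coefficient sequences.
  Series : Set c
  Series = ℕ → Carrier

  infixl 7 _⊛_ _⊘_

  _⊛_ : Series → Series → Series
  (f ⊛ g) n = ∑[ 0 ⋯ n ] λ k → f k * g (n ∸ k)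

  -- f ⊘ g is the series quotient, for g with nonzero constant term: its n-th
  -- coefficient hₙ solves g₀ hₙ + g₁ hₙ₋₁ + … + gₙ h₀ = fₙ, and
  -- quotientPrefix f g n = [ hₙ₋₁ , … , h₀ ].
  mutual
    _⊘_ : Series → Series → Series
    (f ⊘ g) n =
      (f n - sum {n} λ i → g (suc (toℕ i)) * lookup (quotientPrefix f g n) i) / g 0

    quotientPrefix : Series → Series → (n : ℕ) → Vec Carrier n
    quotientPrefix f g zero    = []
    quotientPrefix f g (suc n) = (f ⊘ g) n ∷ quotientPrefix f g n

  -- e^{xt}
  expSeries : Carrier → Series
  expSeries x n = x ^ n / fromℕ (n !)

  constSeries : Carrier → Series
  constSeries x zero    = x
  constSeries x (suc n) = 0#

  -- t · f
  shift : Series → Series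
  shift f zero    = 0#
  shift f (suc n) = f n

  -- e^t - 1
  expSeries-1 : Series
  expSeries-1 n = expSeries 1# n - constSeries 1# n

  -- e^t + 1
  expSeries+1 : Series
  expSeries+1 n = expSeries 1# n + constSeries 1# n

  -- t e^{xt} / (e^t - 1) is read as e^{xt} / ((e^t - 1) / t), whose divisor
  -- has constant term 1.  See Bₙ-generating below.
  Bₙ : ℕ → Carrier → Carrier
  Bₙ n x = fromℕ (n !) * (expSeries x ⊘ λ k → expSeries-1 (suc k)) n

  -- From 2 e^{xt} / (e^t + 1); see Eₙ-generating below.
  Eₙ : ℕ → Carrier → Carrier
  Eₙ n x = fromℕ (n !) * ((λ k → fromℕ 2 * expSeries x k) ⊘ expSeries+1) n

  𝓑 : ℕ → Carrier → Carrier
  𝓑 n x = Bₙ n (x - fromℤ ⌊ x ⌋)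

  -- The function equal to Eₙ on [0,1) with 𝓔ₙ(x + m) = (-1)^m 𝓔ₙ(x) for
  -- integers m; see 𝓔-unit and 𝓔-shift below.
  𝓔 : ℕ → Carrier → Carrier
  𝓔 n x = (- 1#) ^ℤ ⌊ x ⌋ * Eₙ n (x - fromℤ ⌊ x ⌋)

  -- Meaningful for p ≥ 1 and c ≥ 1.
  S³⁵ : (p q : ℕ) (a b : ℤ) (c : ℕ) (x y z : Carrier) → Carrier
  S³⁵ p q a b c x y z = ∑[ 0 ⋯ c ∸ 1 ] λ μ →
    (- 1#) ^ μ
      * 𝓔 (p ∸ 1) (fromℤ a * ((fromℕ μ + z) / fromℕ c) + x)
      * 𝓑 q (fromℤ b * ((fromℕ μ + z) / fromℕ c) + y)

  -- Meaningful for p, q ≥ 1 and c ≥ 1.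
  S⁴ : (p q : ℕ) (a b : ℤ) (c : ℕ) (x y z : Carrier) → Carrier
  S⁴ p q a b c x y z = ∑[ 0 ⋯ c ∸ 1 ] λ μ →
    𝓔 (p ∸ 1) (fromℤ a * ((fromℕ μ + z) / fromℕ c) + x)
      * 𝓔 (q ∸ 1) (fromℤ b * ((fromℕ μ + z) / fromℕ c) + y)

  ----------------------------------------------------------------------
  -- Agreement with the generating functions and with the characterisation of 𝓔

  private
    open RingProperties ring
    open SemiringMult semiring using (×-homo-+)
    open SemiringExp semiring using (^-congˡ; ^-homo-*)
    open SemiringSum semiring using (sum-cong-≋)
    open IsDecTotalOrder isDecTotalOrder
      using (total; antisym; ≤-respˡ-≈; ≤-respʳ-≈)
      renaming (trans to ≤-trans; refl to ≤-refl)
    open SetoidReasoning setoid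

  +-monoʳ-≤ : ∀ z {x y} → x ≤ y → z + x ≤ z + y
  +-monoʳ-≤ z p = ≤-respˡ-≈ (+-comm _ _) (≤-respʳ-≈ (+-comm _ _) (+-monoˡ-≤ z p))

  0≤1 : 0# ≤ 1#
  0≤1 with total 0# 1#
  ... | inj₁ p = p
  ... | inj₂ p = ≤-respʳ-≈ [-1]²≈1 (*-nonNegative 0≤-1 0≤-1)
    where
    0≤-1 : 0# ≤ - 1#
    0≤-1 = ≤-respˡ-≈ (-‿inverseʳ 1#) (≤-respʳ-≈ (+-identityˡ (- 1#)) (+-monoˡ-≤ (- 1#) p))
    [-1]²≈1 : (- 1#) * (- 1#) ≈ 1#
    [-1]²≈1 = trans (-1*x≈-x (- 1#)) (-‿involutive 1#)

  0≤fromℕ : ∀ n → 0# ≤ fromℕ n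
  0≤fromℕ zero    = ≤-refl
  0≤fromℕ (suc n) = ≤-trans (≤-respʳ-≈ (sym (+-identityʳ 1#)) 0≤1) (+-monoʳ-≤ 1# (0≤fromℕ n))

  fromℕ-suc≉0 : ∀ n → ¬ (fromℕ (suc n) ≈ 0#)
  fromℕ-suc≉0 n e = 1≉0 (antisym 1≤0 0≤1)
    where
    1≤0 : 1# ≤ 0#
    1≤0 = ≤-respʳ-≈ e (≤-respˡ-≈ (+-identityʳ 1#) (+-monoʳ-≤ 1# (0≤fromℕ n)))

  fromℕ≉0 : ∀ n .{{_ : ℕ.NonZero n}} → ¬ (fromℕ n ≈ 0#)
  fromℕ≉0 (suc n) = fromℕ-suc≉0 n

  n!≉0 : ∀ n → ¬ (fromℕ (n !) ≈ 0#)
  n!≉0 n = fromℕ≉0 (n !) {{ℕ._!≢0 n}}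

  /-cancelˡ : ∀ {x} → ¬ (x ≈ 0#) → ∀ y → x * (y / x) ≈ y
  /-cancelˡ {x} x≉0 y = begin
    x * (y * x ⁻¹) ≈⟨ *-congˡ (*-comm y _) ⟩
    x * (x ⁻¹ * y) ≈⟨ *-assoc x _ y ⟨
    x * x ⁻¹ * y   ≈⟨ *-congʳ (⁻¹-inverseʳ x≉0) ⟩
    1# * y         ≈⟨ *-identityˡ y ⟩
    y              ∎

  /-cancelʳ : ∀ {x} → ¬ (x ≈ 0#) → ∀ y → x * y / x ≈ y
  /-cancelʳ x≉0 y = trans (*-assoc _ _ _) (/-cancelˡ x≉0 y)

  x-y+y≈x : ∀ x y → x - y + y ≈ x
  x-y+y≈x x y = begin
    x - y + y     ≈⟨ +-assoc x (- y) y ⟩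
    x + (- y + y) ≈⟨ +-congˡ (-‿inverseˡ y) ⟩
    x + 0#        ≈⟨ +-identityʳ x ⟩
    x             ∎

  lookup-prefix : ∀ f g n i → lookup (quotientPrefix f g n) i ≡ (f ⊘ g) (n ∸ suc (toℕ i))
  lookup-prefix f g (suc n) zero    = ≡.refl
  lookup-prefix f g (suc n) (suc i) = lookup-prefix f g n i

  sum-ext : ∀ {n} (f g : Fin n → Carrier) → (∀ i → f i ≈ g i) → sum f ≈ sum g
  sum-ext f g e = sum-cong-≋ {x = f} {y = g} e

  ⊛-congʳ : ∀ f (g h : Series) → (∀ n → g n ≈ h n) → ∀ n → (f ⊛ g) n ≈ (f ⊛ h) n
  ⊛-congʳ f g h e n = sum-ext {suc n} (λ i → f (toℕ i) * g (n ∸ toℕ i))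
    (λ i → f (toℕ i) * h (n ∸ toℕ i)) λ i → *-congˡ (e (n ∸ toℕ i))

  ⊘-correct : ∀ f g → ¬ (g 0 ≈ 0#) → ∀ n → (g ⊛ (f ⊘ g)) n ≈ f n
  ⊘-correct f g g₀≉0 n = begin
    g 0 * (f ⊘ g) n + sum {n} rest  ≈⟨ +-cong (/-cancelˡ g₀≉0 _) rest≈ ⟩
    f n - sum {n} rest′ + sum rest′ ≈⟨ x-y+y≈x (f n) _ ⟩
    f n                             ∎
    where
    rest rest′ : Fin n → Carrier
    rest  i = g (suc (toℕ i)) * (f ⊘ g) (n ∸ suc (toℕ i))
    rest′ i = g (suc (toℕ i)) * lookup (quotientPrefix f g n) i
    rest≈ : sum rest ≈ sum rest′
    rest≈ = sum-ext rest rest′ λ i → *-congˡ (reflexive (≡.sym (lookup-prefix f g n i)))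

  -- (e^t - 1) ∑ₙ Bₙ(x) tⁿ/n! = t e^{xt}
  Bₙ-generating : ∀ x n →
    (expSeries-1 ⊛ λ k → Bₙ k x / fromℕ (k !)) n ≈ shift (expSeries x) n
  Bₙ-generating x n = trans (⊛-congʳ expSeries-1 _ h (λ k → /-cancelʳ (n!≉0 k) _) n) (go n)
    where
    d h : Series
    d k = expSeries-1 (suc k)
    h = expSeries x ⊘ d
    1⁻¹≈1 : fromℕ 1 ⁻¹ ≈ 1#
    1⁻¹≈1 = begin
      fromℕ 1 ⁻¹           ≈⟨ *-identityˡ _ ⟨
      1# * fromℕ 1 ⁻¹      ≈⟨ *-congʳ (+-identityʳ 1#) ⟨
      fromℕ 1 * fromℕ 1 ⁻¹ ≈⟨ ⁻¹-inverseʳ (fromℕ-suc≉0 0) ⟩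
      1#                   ∎
    d₀≈1 : d 0 ≈ 1#
    d₀≈1 = begin
      1# * 1# * fromℕ 1 ⁻¹ - 0# ≈⟨ +-congˡ -0#≈0# ⟩
      1# * 1# * fromℕ 1 ⁻¹ + 0# ≈⟨ +-identityʳ _ ⟩
      1# * 1# * fromℕ 1 ⁻¹      ≈⟨ *-cong (*-identityʳ 1#) 1⁻¹≈1 ⟩
      1# * 1#                   ≈⟨ *-identityʳ 1# ⟩
      1#                        ∎
    c₀≈0 : expSeries-1 0 ≈ 0#
    c₀≈0 = trans (+-congʳ (trans (*-identityˡ _) 1⁻¹≈1)) (-‿inverseʳ 1#)
    go : ∀ n → (expSeries-1 ⊛ h) n ≈ shift (expSeries x) n
    go zero    = trans (+-identityʳ _) (trans (*-congʳ c₀≈0) (zeroˡ _))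
    go (suc n) = begin
      expSeries-1 0 * h (suc n) + (d ⊛ h) n ≈⟨ +-congʳ (trans (*-congʳ c₀≈0) (zeroˡ _)) ⟩
      0# + (d ⊛ h) n                        ≈⟨ +-identityˡ _ ⟩
      (d ⊛ h) n                             ≈⟨ ⊘-correct (expSeries x) d (λ e → 1≉0 (trans (sym d₀≈1) e)) n ⟩
      expSeries x n                         ∎

  -- (e^t + 1) ∑ₙ Eₙ(x) tⁿ/n! = 2 e^{xt}
  Eₙ-generating : ∀ x n →
    (expSeries+1 ⊛ λ k → Eₙ k x / fromℕ (k !)) n ≈ fromℕ 2 * expSeries x n
  Eₙ-generating x n =
    trans (⊛-congʳ expSeries+1 _ (f ⊘ expSeries+1) (λ k → /-cancelʳ (n!≉0 k) _) n)
          (⊘-correct f expSeries+1 (λ e → fromℕ-suc≉0 1 (trans (sym c₀≈2) e)) n)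
    where
    f : Series
    f k = fromℕ 2 * expSeries x k
    c₀≈2 : expSeries+1 0 ≈ fromℕ 2
    c₀≈2 = begin
      1# * fromℕ 1 ⁻¹ + 1#      ≈⟨ +-congʳ (*-congʳ (+-identityʳ 1#)) ⟨
      fromℕ 1 * fromℕ 1 ⁻¹ + 1# ≈⟨ +-congʳ (⁻¹-inverseʳ (fromℕ-suc≉0 0)) ⟩
      1# + 1#                   ≈⟨ +-congˡ (+-identityʳ 1#) ⟨
      fromℕ 2                   ∎

  ⊘-cong : ∀ {f f′ : Series} g → (∀ n → f n ≈ f′ n) → ∀ n → (f ⊘ g) n ≈ (f′ ⊘ g) n
  prefix-cong : ∀ {f f′ : Series} g → (∀ n → f n ≈ f′ n) → ∀ n i →
                lookup (quotientPrefix f g n) i ≈ lookup (quotientPrefix f′ g n) i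
  ⊘-cong {f} {f′} g e n = *-congʳ (+-cong (e n) (-‿cong
    (sum-ext (λ i → g (suc (toℕ i)) * lookup (quotientPrefix f g n) i)
             (λ i → g (suc (toℕ i)) * lookup (quotientPrefix f′ g n) i)
             λ i → *-congˡ (prefix-cong g e n i))))
  prefix-cong g e (suc n) zero    = ⊘-cong g e n
  prefix-cong g e (suc n) (suc i) = prefix-cong g e n i

  Eₙ-cong : ∀ n {x y} → x ≈ y → Eₙ n x ≈ Eₙ n y
  Eₙ-cong n e = *-congˡ (⊘-cong expSeries+1 (λ k → *-congˡ (*-congʳ (^-congˡ k e))) n)

  module _ {x} (x≉0 : ¬ (x ≈ 0#)) where
    ^ℤ-⊖ : ∀ m n → x ^ℤ (m ℤ.⊖ n) ≈ x ^ m * (x ⁻¹) ^ n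
    ^ℤ-⊖ zero    zero    = sym (*-identityˡ _)
    ^ℤ-⊖ zero    (suc n) = sym (*-identityˡ _)
    ^ℤ-⊖ (suc m) zero    = sym (*-identityʳ _)
    ^ℤ-⊖ (suc m) (suc n) = begin
      x ^ℤ (suc m ℤ.⊖ suc n)               ≡⟨ ≡.cong (x ^ℤ_) (ℤ.[1+m]⊖[1+n]≡m⊖n m n) ⟩
      x ^ℤ (m ℤ.⊖ n)                       ≈⟨ ^ℤ-⊖ m n ⟩
      x ^ m * (x ⁻¹) ^ n                   ≈⟨ *-congʳ (/-cancelˡ x≉0 _) ⟨
      x * (x ^ m * x ⁻¹) * (x ⁻¹) ^ n      ≈⟨ *-congʳ (*-assoc _ _ _) ⟨
      x * x ^ m * x ⁻¹ * (x ⁻¹) ^ n        ≈⟨ *-assoc _ _ _ ⟩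
      x * x ^ m * (x ⁻¹ * (x ⁻¹) ^ n)      ∎

    ^ℤ-homo-* : ∀ i j → x ^ℤ (i ℤ.+ j) ≈ x ^ℤ i * x ^ℤ j
    ^ℤ-homo-* (+ m)    (+ n)    = ^-homo-* x m n
    ^ℤ-homo-* (+ m)    -[1+ n ] = ^ℤ-⊖ m (suc n)
    ^ℤ-homo-* -[1+ m ] (+ n)    = trans (^ℤ-⊖ n (suc m)) (*-comm _ _)
    ^ℤ-homo-* -[1+ m ] -[1+ n ] = begin
      (x ⁻¹) ^ suc (suc (m ℕ.+ n)) ≡⟨ ≡.cong (λ k → (x ⁻¹) ^ suc k) (ℕ.+-suc m n) ⟨
      (x ⁻¹) ^ (suc m ℕ.+ suc n)   ≈⟨ ^-homo-* (x ⁻¹) (suc m) (suc n) ⟩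
      (x ⁻¹) ^ suc m * (x ⁻¹) ^ suc n ∎

  fromℤ-⊖ : ∀ m n → fromℤ (m ℤ.⊖ n) ≈ fromℕ m - fromℕ n
  fromℤ-⊖ zero    zero    = sym (-‿inverseʳ _)
  fromℤ-⊖ zero    (suc n) = sym (+-identityˡ _)
  fromℤ-⊖ (suc m) zero    = sym (trans (+-congˡ -0#≈0#) (+-identityʳ _))
  fromℤ-⊖ (suc m) (suc n) = begin
    fromℤ (suc m ℤ.⊖ suc n)               ≡⟨ ≡.cong fromℤ (ℤ.[1+m]⊖[1+n]≡m⊖n m n) ⟩
    fromℤ (m ℤ.⊖ n)                       ≈⟨ fromℤ-⊖ m n ⟩
    fromℕ m - fromℕ n                     ≈⟨ +-congˡ (+-identityˡ _) ⟨
    fromℕ m + (0# - fromℕ n)              ≈⟨ +-congˡ (+-congʳ (-‿inverseʳ 1#)) ⟨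
    fromℕ m + (1# - 1# - fromℕ n)         ≈⟨ +-congˡ (+-assoc _ _ _) ⟩
    fromℕ m + (1# + (- 1# - fromℕ n))     ≈⟨ +-assoc _ _ _ ⟨
    fromℕ m + 1# + (- 1# - fromℕ n)       ≈⟨ +-cong (+-comm _ _) (-‿+-comm 1# (fromℕ n)) ⟩
    fromℕ (suc m) - fromℕ (suc n)         ∎

  fromℤ-homo-+ : ∀ i j → fromℤ (i ℤ.+ j) ≈ fromℤ i + fromℤ j
  fromℤ-homo-+ (+ m)    (+ n)    = ×-homo-+ 1# m n
  fromℤ-homo-+ (+ m)    -[1+ n ] = fromℤ-⊖ m (suc n)
  fromℤ-homo-+ -[1+ m ] (+ n)    = trans (fromℤ-⊖ n (suc m)) (+-comm _ _)
  fromℤ-homo-+ -[1+ m ] -[1+ n ] = begin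
    - fromℕ (suc (suc (m ℕ.+ n)))     ≡⟨ ≡.cong (λ k → - fromℕ (suc k)) (ℕ.+-suc m n) ⟨
    - fromℕ (suc m ℕ.+ suc n)         ≈⟨ -‿cong (×-homo-+ 1# (suc m) (suc n)) ⟩
    - (fromℕ (suc m) + fromℕ (suc n)) ≈⟨ -‿+-comm _ _ ⟨
    - fromℕ (suc m) - fromℕ (suc n)   ∎

  fromℤ-homo-- : ∀ i → fromℤ (ℤ.- i) ≈ - fromℤ i
  fromℤ-homo-- (+ zero)  = sym -0#≈0#
  fromℤ-homo-- (+ suc n) = refl
  fromℤ-homo-- -[1+ n ]  = sym (-‿involutive _)

  x+y-y≈x : ∀ x y → x + y - y ≈ x
  x+y-y≈x x y = begin
    x + y - y   ≈⟨ +-assoc x y (- y) ⟩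
    x + (y - y) ≈⟨ +-congˡ (-‿inverseʳ y) ⟩
    x + 0#      ≈⟨ +-identityʳ x ⟩
    x           ∎

  ⌊⌋-shift : ∀ x m → ⌊ x + fromℤ m ⌋ ≡ ⌊ x ⌋ ℤ.+ m
  ⌊⌋-shift x m = ℤ.≤-antisym upper lower
    where
    lower : ⌊ x ⌋ ℤ.+ m ℤ.≤ ⌊ x + fromℤ m ⌋
    lower = ⌊⌋-greatest _ _
      (≤-respˡ-≈ (sym (fromℤ-homo-+ ⌊ x ⌋ m)) (+-monoˡ-≤ (fromℤ m) (⌊⌋-lowerBound x)))
    n : ℤ
    n = ⌊ x + fromℤ m ⌋
    n-m≤x : fromℤ (n ℤ.- m) ≤ x
    n-m≤x = ≤-respʳ-≈ (x+y-y≈x x (fromℤ m))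
      (≤-respˡ-≈ (sym (trans (fromℤ-homo-+ n (ℤ.- m)) (+-congˡ (fromℤ-homo-- m))))
        (+-monoˡ-≤ (- fromℤ m) (⌊⌋-lowerBound (x + fromℤ m))))
    n-m+m≡n : n ℤ.- m ℤ.+ m ≡ n
    n-m+m≡n = ≡.trans (ℤ.+-assoc n (ℤ.- m) m)
      (≡.trans (≡.cong (λ i → n ℤ.+ i) (ℤ.+-inverseˡ m)) (ℤ.+-identityʳ n))
    upper : n ℤ.≤ ⌊ x ⌋ ℤ.+ m
    upper = ≡.subst (ℤ._≤ ⌊ x ⌋ ℤ.+ m) n-m+m≡n
      (ℤ.+-monoˡ-≤ m (⌊⌋-greatest x (n ℤ.- m) n-m≤x))

  ⌊⌋-unit : ∀ {x} → 0# ≤ x → ¬ (1# ≤ x) → ⌊ x ⌋ ≡ 0ℤ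
  ⌊⌋-unit {x} 0≤x 1≰x = ℤ.≤-antisym (ℤ.≮⇒≥ ⌊x⌋≯0) (⌊⌋-greatest x 0ℤ 0≤x)
    where
    1≤fromℤ : ∀ {i} → 0ℤ ℤ.< i → 1# ≤ fromℤ i
    1≤fromℤ {+ suc n} _ = ≤-respˡ-≈ (+-identityʳ 1#) (+-monoʳ-≤ 1# (0≤fromℕ n))
    1≤fromℤ {+ zero} (ℤ.+<+ ())
    ⌊x⌋≯0 : ¬ (0ℤ ℤ.< ⌊ x ⌋)
    ⌊x⌋≯0 p = 1≰x (≤-trans (1≤fromℤ p) (⌊⌋-lowerBound x))

  -1≉0 : ¬ (- 1# ≈ 0#)
  -1≉0 e = 1≉0 (trans (sym (-‿involutive 1#)) (trans (-‿cong e) -0#≈0#))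

  𝓔-unit : ∀ n {x} → 0# ≤ x → ¬ (1# ≤ x) → 𝓔 n x ≈ Eₙ n x
  𝓔-unit n {x} 0≤x 1≰x = begin
    (- 1#) ^ℤ ⌊ x ⌋ * Eₙ n (x - fromℤ ⌊ x ⌋) ≡⟨ ≡.cong (λ m → (- 1#) ^ℤ m * Eₙ n (x - fromℤ m)) (⌊⌋-unit 0≤x 1≰x) ⟩
    1# * Eₙ n (x - 0#)                       ≈⟨ *-identityˡ _ ⟩
    Eₙ n (x - 0#)                            ≈⟨ Eₙ-cong n (trans (+-congˡ -0#≈0#) (+-identityʳ x)) ⟩
    Eₙ n x                                   ∎

  𝓔-shift : ∀ n x m → 𝓔 n (x + fromℤ m) ≈ (- 1#) ^ℤ m * 𝓔 n x
  𝓔-shift n x m = begin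
    (- 1#) ^ℤ ⌊ x + k ⌋ * Eₙ n (x + k - fromℤ ⌊ x + k ⌋)     ≡⟨ ≡.cong (λ i → (- 1#) ^ℤ i * Eₙ n (x + k - fromℤ i)) (⌊⌋-shift x m) ⟩
    (- 1#) ^ℤ (l ℤ.+ m) * Eₙ n (x + k - fromℤ (l ℤ.+ m))     ≈⟨ *-cong (^ℤ-homo-* -1≉0 l m) (Eₙ-cong n frac) ⟩
    (- 1#) ^ℤ l * (- 1#) ^ℤ m * Eₙ n (x - fromℤ l)           ≈⟨ *-congʳ (*-comm _ _) ⟩
    (- 1#) ^ℤ m * (- 1#) ^ℤ l * Eₙ n (x - fromℤ l)           ≈⟨ *-assoc _ _ _ ⟩
    (- 1#) ^ℤ m * ((- 1#) ^ℤ l * Eₙ n (x - fromℤ l))         ∎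
    where
    k : Carrier
    k = fromℤ m
    l : ℤ
    l = ⌊ x ⌋
    frac : x + k - fromℤ (l ℤ.+ m) ≈ x - fromℤ l
    frac = begin
      x + k - fromℤ (l ℤ.+ m)     ≈⟨ +-congˡ (-‿cong (trans (fromℤ-homo-+ l m) (+-comm _ _))) ⟩
      x + k - (k + fromℤ l)       ≈⟨ +-congˡ (-‿+-comm k (fromℤ l)) ⟨
      x + k + (- k - fromℤ l)     ≈⟨ +-assoc _ _ _ ⟨
      x + k - k - fromℤ l         ≈⟨ +-congʳ (x+y-y≈x x k) ⟩
      x - fromℤ l                 ∎

{-# OPTIONS --safe #-}

-- Since a and c are coprime with even sum, both are odd.  With X = (l + x)/a,
-- Y = (n + y)/b and Z = (m + z)/c, the multiplication formulas
--   𝓔ₖ(au) = aᵏ ∑_{l<a} (-1)ˡ 𝓔ₖ(u + l/a)   and   b 𝓑ₖ(bu) = bᵏ ∑_{n<b} 𝓑ₖ(u + n/b)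
-- turn all three Dedekind sums into sums over (l, m, n) with the common sign
-- (-1)^(l+m), and the theorem becomes an identity between single terms.  With
-- r = X - Y and t = Y + Z it reads
--   𝓔_{p-1}(r+t) 𝓑_q(t) = - q/2 ∑ⱼ C(p-1,j) 𝓔ⱼ(r) 𝓔_{p+q-2-j}(t)
--                         + ∑ₕ C(q,h) (-1)ʰ 𝓑ₕ(r) 𝓔_{p+q-1-h}(r+t).
-- For r, t ∈ [0,1) this compares coefficients in a partial fraction decomposition
-- of 1/((eᵘ + 1)(eᵛ - 1)) over the denominator eᵘ⁺ᵛ + 1, of which there is one for
-- r + t < 1 and another for r + t ≥ 1.  Exponential generating functions are handled
-- as Hurwitz series: coefficient sequences with the binomial convolution, on which
-- differentiation is the index shift.
module Submission where

open import Defs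
open import Algebra.Bundles using (CommutativeRing)
import Algebra.Properties.CommutativeSemiring.Exp as CommutativeSemiringExp
import Algebra.Properties.Ring as RingProperties
import Algebra.Properties.Semiring.Exp as SemiringExp
import Algebra.Properties.Semiring.Mult as SemiringMult
import Algebra.Properties.Semiring.Mult.TCOptimised as SemiringMult′
import Algebra.Properties.Semiring.Sum as SemiringSum
import Algebra.Solver.Ring as RingSolver
open import Algebra.Solver.Ring.AlmostCommutativeRing using (fromCommutativeRing; _-Raw-AlmostCommutative⟶_)
import Algebra.Solver.Ring.NaturalCoefficients.Default as SemiringSolver
open import Data.Empty using (⊥-elim)
open import Data.Fin.Base using (toℕ)
import Data.Fin.Properties as Fin
open import Data.Integer as ℤ using (ℤ; +_; -[1+_]; 0ℤ)
import Data.Integer.Properties as ℤ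
import Data.Integer.Solver as ℤSolver
open import Data.Maybe.Base using (Maybe; just; nothing)
open import Data.Nat as ℕ using (ℕ; zero; suc; NonZero; _∸_; _!; z≤n; s≤s)
open import Data.Nat.Combinatorics using (_C_; nCk≡n!/k![n-k]!; k![n∸k]!∣n!; nCk+nC[k+1]≡[n+1]C[k+1]; k>n⇒nCk≡0)
open import Data.Nat.Coprimality using (Coprime)
open import Data.Nat.Divisibility using (_∣_; ∣m+n∣m⇒∣n; ∣m∣n⇒∣m+n; ∣-refl; _∣0)
open import Data.Nat.DivMod using (m*[n/m]≡n)
import Data.Nat.Properties as ℕ
open import Data.Product.Base using (_,_)
open import Data.Sum.Base using (_⊎_; inj₁; inj₂)
open import Level using (_⊔_)
import Relation.Binary.PropositionalEquality as ≡
open ≡ using (_≡_)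
import Relation.Binary.Reasoning.Setoid as SetoidReasoning
open import Relation.Binary.Structures using (IsDecTotalOrder)
open import Relation.Nullary using (¬_; yes; no)

-- As series, neither t nor 1 - eᵗ is invertible. Generating functions therefore enter through
-- equations such as `V ⋆ b ≋ b ⊕ var`, fractions are compared after multiplying out, and the only
-- series ever cancelled are nonzero constants and t up to sign. Oddness of a matters because (-1)ᵃ
-- = -1 makes 1 + e^(at) equal to 1 - (-eᵗ)ᵃ, hence 1 + eᵗ times a geometric sum; this is the
-- multiplication formula for 𝓔. Each Dedekind sum already runs over one of l, m, n. Its two factors
-- supply the other two indices, and the powers of a, b, c in the theorem are those that cancel the
-- powers so produced. In the single-term identity the factor q comes from the numerator v of v/(eᵛ
-- - 1), the 1/2 from the numerators 2 of the Euler series, and (-1)ʰ from the reflection Bₕ(1 - r)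
-- = (-1)ʰ Bₕ(r). For r + t ≥ 1 the decomposition has the cross term on the other side; the sign in
-- 𝓔(r + t) = -E(r + t - 1) moves it back, so both cases give the same formula.

-- The ring of Hurwitz series.

module Hurwitz {c ℓ} (R : CommutativeRing c ℓ) where
  private
    module R = CommutativeRing R
    module S = SemiringSolver R.commutativeSemiring
    module RP = RingProperties R.ring
    open S using (_:+_; _:*_; _:=_)
  open R using (_≈_)

  Ser : Set c
  Ser = ℕ → R.Carrier

  infix 4 _≋_
  -- A record rather than a bare pointwise statement, so that unification can recover the two series
  -- from an equality.
  record _≋_ (f g : Ser) : Set ℓ where
    constructor mk
    field at : ∀ n → f n ≈ g n
  open _≋_ public

  D : Ser → Ser
  D f n = f (suc n)

  infixl 6 _⊕_
  infixl 7 _⋆_ _•_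

  _⊕_ : Ser → Ser → Ser
  (f ⊕ g) n = f n R.+ g n

  ⊖_ : Ser → Ser
  (⊖ f) n = R.- f n

  _•_ : R.Carrier → Ser → Ser
  (x • f) n = x R.* f n

  const : R.Carrier → Ser
  const x zero    = x
  const x (suc n) = R.0#

  -- A series is determined by its constant term and its derivative, so the Leibniz rule itself
  -- serves as definition. The ring laws then follow by induction on the index, for all series at
  -- once; binomial coefficients appear only in `⋆-binomial`.
  _⋆_ : Ser → Ser → Ser
  (f ⋆ g) zero    = f zero R.* g zero
  (f ⋆ g) (suc n) = (D f ⋆ g) n R.+ (f ⋆ D g) n

  D-cong : ∀ {f g} → f ≋ g → D f ≋ D g
  D-cong e .at n = e .at (suc n)

  ⋆-cong : ∀ {f f′ g g′} → f ≋ f′ → g ≋ g′ → f ⋆ g ≋ f′ ⋆ g′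
  ⋆-cong p q .at zero    = R.*-cong (p .at 0) (q .at 0)
  ⋆-cong p q .at (suc n) = R.+-cong (⋆-cong (D-cong p) q .at n) (⋆-cong p (D-cong q) .at n)

  ⋆-comm : ∀ f g → f ⋆ g ≋ g ⋆ f
  ⋆-comm f g .at zero    = R.*-comm _ _
  ⋆-comm f g .at (suc n) =
    R.trans (R.+-cong (⋆-comm (D f) g .at n) (⋆-comm f (D g) .at n)) (R.+-comm _ _)

  ⋆-distribʳ : ∀ h f g → (f ⊕ g) ⋆ h ≋ f ⋆ h ⊕ g ⋆ h
  ⋆-distribʳ h f g .at zero    = R.distribʳ _ _ _
  ⋆-distribʳ h f g .at (suc n) =
    R.trans (R.+-cong (⋆-distribʳ h (D f) (D g) .at n) (⋆-distribʳ (D h) f g .at n))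
      (S.solve 4 (λ a b c d → (a :+ b) :+ (c :+ d) := (a :+ c) :+ (b :+ d)) R.refl _ _ _ _)

  ⋆-distribˡ : ∀ h f g → h ⋆ (f ⊕ g) ≋ h ⋆ f ⊕ h ⋆ g
  ⋆-distribˡ h f g .at n = R.trans (⋆-comm h (f ⊕ g) .at n)
    (R.trans (⋆-distribʳ h f g .at n) (R.+-cong (⋆-comm f h .at n) (⋆-comm g h .at n)))

  ⋆-assoc : ∀ f g h → (f ⋆ g) ⋆ h ≋ f ⋆ (g ⋆ h)
  ⋆-assoc f g h .at zero    = R.*-assoc _ _ _
  ⋆-assoc f g h .at (suc n) = begin
    (D (f ⋆ g) ⋆ h) n R.+ ((f ⋆ g) ⋆ D h) n
      ≈⟨ R.+-congʳ (⋆-distribʳ h (D f ⋆ g) (f ⋆ D g) .at n) ⟩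
    ((D f ⋆ g) ⋆ h) n R.+ ((f ⋆ D g) ⋆ h) n R.+ ((f ⋆ g) ⋆ D h) n
      ≈⟨ R.+-cong (R.+-cong (⋆-assoc (D f) g h .at n) (⋆-assoc f (D g) h .at n)) (⋆-assoc f g (D h) .at n) ⟩
    (D f ⋆ (g ⋆ h)) n R.+ (f ⋆ (D g ⋆ h)) n R.+ (f ⋆ (g ⋆ D h)) n
      ≈⟨ R.+-assoc _ _ _ ⟩
    (D f ⋆ (g ⋆ h)) n R.+ ((f ⋆ (D g ⋆ h)) n R.+ (f ⋆ (g ⋆ D h)) n)
      ≈⟨ R.+-congˡ (⋆-distribˡ f (D g ⋆ h) (g ⋆ D h) .at n) ⟨
    (D f ⋆ (g ⋆ h)) n R.+ (f ⋆ D (g ⋆ h)) n ∎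
    where open SetoidReasoning R.setoid

  const-⋆ : ∀ x f → const x ⋆ f ≋ x • f
  0-⋆ : ∀ f n → ((λ _ → R.0#) ⋆ f) n ≈ R.0#
  const-⋆ x f .at zero    = R.refl
  const-⋆ x f .at (suc n) = R.trans (R.+-cong (0-⋆ f n) (const-⋆ x (D f) .at n)) (R.+-identityˡ _)
  0-⋆ f zero    = R.zeroˡ _
  0-⋆ f (suc n) = R.trans (R.+-cong (0-⋆ f n) (0-⋆ (D f) n)) (R.+-identityˡ _)

  ⋆-identityˡ : ∀ f → const R.1# ⋆ f ≋ f
  ⋆-identityˡ f .at n = R.trans (const-⋆ R.1# f .at n) (R.*-identityˡ _)

  commutativeRing : CommutativeRing c ℓ
  commutativeRing = record
    { Carrier = Ser
    ; _≈_ = _≋_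
    ; _+_ = _⊕_
    ; _*_ = _⋆_
    ; -_  = ⊖_
    ; 0#  = λ _ → R.0#
    ; 1#  = const R.1#
    ; isCommutativeRing = record
      { isRing = record
        { +-isAbelianGroup = record
          { isGroup = record
            { isMonoid = record
              { isSemigroup = record
                { isMagma = record
                  { isEquivalence = record
                    { refl  = mk λ _ → R.refl
                    ; sym   = λ p → mk λ n → R.sym (p .at n)
                    ; trans = λ p q → mk λ n → R.trans (p .at n) (q .at n)
                    }
                  ; ∙-cong = λ p q → mk λ n → R.+-cong (p .at n) (q .at n)
                  }
                ; assoc = λ f g h → mk λ n → R.+-assoc _ _ _
                }
              ; identity = (λ f → mk λ n → R.+-identityˡ _) , (λ f → mk λ n → R.+-identityʳ _)
              }
            ; inverse = (λ f → mk λ n → R.-‿inverseˡ _) , (λ f → mk λ n → R.-‿inverseʳ _)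
            ; ⁻¹-cong = λ p → mk λ n → R.-‿cong (p .at n)
            }
          ; comm = λ f g → mk λ n → R.+-comm _ _
          }
        ; *-cong = ⋆-cong
        ; *-assoc = ⋆-assoc
        ; *-identity = ⋆-identityˡ , λ f → mk λ n →
            R.trans (⋆-comm f (const R.1#) .at n) (⋆-identityˡ f .at n)
        ; distrib = ⋆-distribˡ , ⋆-distribʳ
        }
      ; *-comm = ⋆-comm
      }
    }

  const-cong : ∀ {x y} → x ≈ y → const x ≋ const y
  const-cong e .at zero    = e
  const-cong e .at (suc n) = R.refl

  const-+ : ∀ x y → const (x R.+ y) ≋ const x ⊕ const y
  const-+ x y .at zero    = R.refl
  const-+ x y .at (suc n) = R.sym (R.+-identityˡ _)

  const-* : ∀ x y → const (x R.* y) ≋ const x ⋆ const y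
  const-* x y .at zero    = R.refl
  const-* x y .at (suc n) = R.sym (R.trans (const-⋆ x (const y) .at (suc n)) (R.zeroʳ _))

  •-⋆ : ∀ x f g → (x • f) ⋆ g ≋ x • (f ⋆ g)
  •-⋆ x f g .at zero    = R.*-assoc _ _ _
  •-⋆ x f g .at (suc n) =
    R.trans (R.+-cong (•-⋆ x (D f) g .at n) (•-⋆ x f (D g) .at n)) (R.sym (R.distribˡ _ _ _))

  ⋆-• : ∀ x f g → f ⋆ (x • g) ≋ x • (f ⋆ g)
  ⋆-• x f g .at zero    = S.solve 3 (λ a b c → b :* (a :* c) := a :* (b :* c)) R.refl _ _ _
  ⋆-• x f g .at (suc n) =
    R.trans (R.+-cong (⋆-• x (D f) g .at n) (⋆-• x f (D g) .at n)) (R.sym (R.distribˡ _ _ _))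

-- H (H R) as series in two variables: F m n is the coefficient of uᵐvⁿ/m!n!.
module Bivariate {c ℓ} (R : CommutativeRing c ℓ) where
  private module R = CommutativeRing R
  module H₁ = Hurwitz R
  module H₂ = Hurwitz H₁.commutativeRing
  private
    module CH₁ = CommutativeRing H₁.commutativeRing
    module CH₂ = CommutativeRing H₂.commutativeRing
  open H₁ using (Ser; at; D) renaming (_≋_ to _≋₁_; _⋆_ to _⋆₁_; _⊕_ to _⊕₁_; const to const₁)
  open H₂ using () renaming (_≋_ to _≋₂_; _⋆_ to _⋆₂_; _⊕_ to _⊕₂_; const to const₂)

  -- The outer index belongs to u, the inner one to v. For f(u+v) no binomial coefficient is needed,
  -- because its mixed derivative of order (m, n) at 0 is the derivative of f of order m + n.
  inU inV inU+V : Ser → H₂.Ser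
  inU f m     = const₁ (f m)
  inV f       = const₂ f
  inU+V f m n = f (m ℕ.+ n)

  inU-cong : ∀ {f g} → f ≋₁ g → inU f ≋₂ inU g
  inU-cong e .H₂.at m = H₁.const-cong (e .at m)

  inU-+ : ∀ f g → inU (f ⊕₁ g) ≋₂ inU f ⊕₂ inU g
  inU-+ f g .H₂.at m = H₁.const-+ _ _

  inU-* : ∀ f g → inU (f ⋆₁ g) ≋₂ inU f ⋆₂ inU g
  inU-* f g .H₂.at zero    = H₁.const-* _ _
  inU-* f g .H₂.at (suc m) = CH₁.trans (H₁.const-+ _ _)
    (CH₁.+-cong (inU-* (D f) g .H₂.at m) (inU-* f (D g) .H₂.at m))

  inU+V-cong : ∀ {f g} → f ≋₁ g → inU+V f ≋₂ inU+V g
  inU+V-cong e .H₂.at m .at n = e .at (m ℕ.+ n)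

  -- Differentiating f(u+v) in u gives (D f)(u+v), so both sides obey the same Leibniz recursion in
  -- the outer index.
  inU+V-* : ∀ f g → inU+V (f ⋆₁ g) ≋₂ inU+V f ⋆₂ inU+V g
  inU+V-* f g .H₂.at zero    = CH₁.refl
  inU+V-* f g .H₂.at (suc m) =
    CH₁.+-cong (inU+V-* (D f) g .H₂.at m) (inU+V-* f (D g) .H₂.at m)

  ⋆-inU : ∀ F g m n → (F ⋆₂ inU g) m n R.≈ ((λ k → F k n) ⋆₁ g) m
  ⋆-inU F g zero    n = R.trans (H₁.⋆-comm (F 0) (const₁ (g 0)) .at n)
    (R.trans (H₁.const-⋆ (g 0) (F 0) .at n) (R.*-comm _ _))
  ⋆-inU F g (suc m) n = R.+-cong (⋆-inU (H₂.D F) g m n) (⋆-inU F (D g) m n)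

  ⋆-inV : ∀ F g m n → (F ⋆₂ inV g) m n R.≈ (F m ⋆₁ g) n
  ⋆-inV F g m n = R.trans (H₂.⋆-comm F (const₂ g) .H₂.at m .at n)
    (R.trans (H₂.const-⋆ g F .H₂.at m .at n) (H₁.⋆-comm g (F m) .at n))

-- A ring solver over the reals with integer coefficients.

module RealArith {c₀ ℓ₁ ℓ₂} (ℝ : RealField c₀ ℓ₁ ℓ₂) where
  open Dedekind ℝ
  open RingProperties ring
  open SemiringMult semiring using (×1-homo-*)
  open SemiringMult′ semiring using (_×_; ×ᵤ≈×)
  open SetoidReasoning setoid

  fromℤ-homo-* : ∀ i j → fromℤ (i ℤ.* j) ≈ fromℤ i * fromℤ j
  fromℤ-homo-* (+ m)    (+ n)    = begin
    fromℤ (+ m ℤ.* + n)       ≡⟨ ≡.cong fromℤ (ℤ.pos-* m n) ⟨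
    fromℤ (+ (m ℕ.* n))       ≈⟨ ×1-homo-* m n ⟩
    fromℤ (+ m) * fromℤ (+ n) ∎
  fromℤ-homo-* (+ m)    -[1+ n ] = begin
    fromℤ (+ m ℤ.* -[1+ n ])         ≡⟨ ≡.cong fromℤ (ℤ.-◃n≡-n (m ℕ.* suc n)) ⟩
    fromℤ (ℤ.- + (m ℕ.* suc n))      ≈⟨ fromℤ-homo-- (+ (m ℕ.* suc n)) ⟩
    - fromℤ (+ (m ℕ.* suc n))        ≈⟨ -‿cong (×1-homo-* m (suc n)) ⟩
    - (fromℤ (+ m) * fromℤ (+ suc n)) ≈⟨ -‿distribʳ-* _ _ ⟩
    fromℤ (+ m) * fromℤ -[1+ n ]     ∎
  fromℤ-homo-* -[1+ m ] (+ n)    = begin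
    fromℤ (-[1+ m ] ℤ.* + n)          ≡⟨ ≡.cong fromℤ (ℤ.-◃n≡-n (suc m ℕ.* n)) ⟩
    fromℤ (ℤ.- + (suc m ℕ.* n))       ≈⟨ fromℤ-homo-- (+ (suc m ℕ.* n)) ⟩
    - fromℤ (+ (suc m ℕ.* n))         ≈⟨ -‿cong (×1-homo-* (suc m) n) ⟩
    - (fromℤ (+ suc m) * fromℤ (+ n)) ≈⟨ -‿distribˡ-* _ _ ⟩
    fromℤ -[1+ m ] * fromℤ (+ n)      ∎
  fromℤ-homo-* -[1+ m ] -[1+ n ] = begin
    fromℤ (+ (suc m ℕ.* suc n))           ≈⟨ ×1-homo-* (suc m) (suc n) ⟩
    fromℤ (+ suc m) * fromℤ (+ suc n)     ≈⟨ -x*-y≈x*y _ _ ⟨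
    fromℤ -[1+ m ] * fromℤ -[1+ n ]       ∎
    where
    -x*-y≈x*y : ∀ x y → - x * - y ≈ x * y
    -x*-y≈x*y x y = trans (sym (-‿distribˡ-* x (- y)))
      (trans (-‿cong (sym (-‿distribʳ-* x y))) (-‿involutive _))

  -- Unlike fromℤ, this maps 1 to 1# on the nose, which the solver below needs.
  coefficient : ℤ → Carrier
  coefficient (+ n)    = n × 1#
  coefficient -[1+ n ] = - (suc n × 1#)

  fromℤ≈coefficient : ∀ i → fromℤ i ≈ coefficient i
  fromℤ≈coefficient (+ n)    = ×ᵤ≈× n 1#
  fromℤ≈coefficient -[1+ n ] = -‿cong (×ᵤ≈× (suc n) 1#)

  coefficientMorphism : ℤ.+-*-rawRing -Raw-AlmostCommutative⟶ fromCommutativeRing commutativeRing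
  coefficientMorphism = record
    { ⟦_⟧    = coefficient
    ; +-homo = λ i j → via (i ℤ.+ j) (trans (fromℤ-homo-+ i j) (+-cong (fromℤ≈coefficient i) (fromℤ≈coefficient j)))
    ; *-homo = λ i j → via (i ℤ.* j) (trans (fromℤ-homo-* i j) (*-cong (fromℤ≈coefficient i) (fromℤ≈coefficient j)))
    ; -‿homo = λ i → via (ℤ.- i) (trans (fromℤ-homo-- i) (-‿cong (fromℤ≈coefficient i)))
    ; 0-homo = refl
    ; 1-homo = refl
    }
    where
    via : ∀ i {x} → fromℤ i ≈ x → coefficient i ≈ x
    via i e = trans (sym (fromℤ≈coefficient i)) e

  coefficient≟ : ∀ i j → Maybe (coefficient i ≈ coefficient j)
  coefficient≟ i j with i ℤ.≟ j
  ... | yes ≡.refl = just refl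
  ... | no  _      = nothing

  module Solver = RingSolver ℤ.+-*-rawRing (fromCommutativeRing commutativeRing) coefficientMorphism coefficient≟

-- Sums over initial segments of ℕ.

module FiniteSums {c₀ ℓ₁ ℓ₂} (ℝ : RealField c₀ ℓ₁ ℓ₂) where
  open Dedekind ℝ
  open SemiringSum semiring using (sum; ∑-distrib-+; ∑-comm; *-distribˡ-sum; *-distribʳ-sum)
  open SetoidReasoning setoid

  -- Opaque, so that unification can recover the summand from a sum.
  opaque
    ∑< : ℕ → (ℕ → Carrier) → Carrier
    ∑< n f = sum {n} λ i → f (toℕ i)

    ∑[0⋯n]≡∑< : ∀ n f → ∑[ 0 ⋯ n ] f ≡ ∑< (suc n) f
    ∑[0⋯n]≡∑< n f = ≡.refl

    ∑[1⋯n]≡∑< : ∀ n f → ∑[ 1 ⋯ n ] f ≡ ∑< n λ k → f (suc k)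
    ∑[1⋯n]≡∑< n f = ≡.refl

    ∑<-zero : ∀ f → ∑< 0 f ≡ 0#
    ∑<-zero f = ≡.refl

    ∑<-suc : ∀ n f → ∑< (suc n) f ≡ f 0 + ∑< n (λ k → f (suc k))
    ∑<-suc n f = ≡.refl

    ∑<-cong : ∀ n {f g : ℕ → Carrier} → (∀ k → k ℕ.< n → f k ≈ g k) → ∑< n f ≈ ∑< n g
    ∑<-cong n e = sum-ext {n} _ _ λ i → e (toℕ i) (Fin.toℕ<n i)

    ∑<-cong′ : ∀ n {f g : ℕ → Carrier} → (∀ k → f k ≈ g k) → ∑< n f ≈ ∑< n g
    ∑<-cong′ n e = ∑<-cong n λ k _ → e k

    ∑<-+ : ∀ n f g → ∑< n (λ k → f k + g k) ≈ ∑< n f + ∑< n g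
    ∑<-+ n f g = ∑-distrib-+ {n} (λ i → f (toℕ i)) (λ i → g (toℕ i))

    ∑<-*ˡ : ∀ n x f → x * ∑< n f ≈ ∑< n (λ k → x * f k)
    ∑<-*ˡ n x f = *-distribˡ-sum {n} x (λ i → f (toℕ i))

    ∑<-*ʳ : ∀ n x f → ∑< n f * x ≈ ∑< n (λ k → f k * x)
    ∑<-*ʳ n x f = *-distribʳ-sum {n} x (λ i → f (toℕ i))

    ∑<-comm : ∀ m n (f : ℕ → ℕ → Carrier) → ∑< m (λ i → ∑< n (f i)) ≈ ∑< n (λ j → ∑< m (λ i → f i j))
    ∑<-comm m n f = ∑-comm {m} {n} λ i j → f (toℕ i) (toℕ j)

    ∑<-last : ∀ n f → ∑< (suc n) f ≈ ∑< n f + f n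
    ∑<-last zero    f = +-comm _ _
    ∑<-last (suc n) f = trans (+-congˡ (∑<-last n (λ k → f (suc k)))) (sym (+-assoc _ _ _))

    ∑<-reverse : ∀ n f → ∑< n f ≈ ∑< n (λ k → f (n ∸ suc k))
    ∑<-reverse zero    f = refl
    ∑<-reverse (suc n) f = begin
      ∑< (suc n) f                              ≈⟨ ∑<-last n f ⟩
      ∑< n f + f n                              ≈⟨ +-comm _ _ ⟩
      f n + ∑< n f                              ≈⟨ +-congˡ (∑<-reverse n f) ⟩
      f n + ∑< n (λ k → f (n ∸ suc k))          ∎

-- Binomial convolution, and passage from ordinary to exponential coefficients.

module HurwitzReal {c₀ ℓ₁ ℓ₂} (ℝ : RealField c₀ ℓ₁ ℓ₂) where
  open Dedekind ℝ
  open RealArith ℝ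
  open FiniteSums ℝ
  open Hurwitz commutativeRing using (Ser; _≋_; at; D; _⋆_)
  open Solver using (_:+_; _:*_; _:=_; solve)
  open SemiringMult semiring using (×-homo-+; ×1-homo-*)
  open SetoidReasoning setoid

  ⋆-binomial : ∀ f g n → (f ⋆ g) n ≈ ∑< (suc n) λ k → fromℕ (n C k) * (f k * g (n ∸ k))
  ⋆-binomial f g zero    = sym (trans (trans (reflexive (∑<-suc 0 _)) (+-congˡ (reflexive (∑<-zero _))))
    (trans (+-identityʳ _) (trans (*-congʳ (+-identityʳ _)) (*-identityˡ _))))
  ⋆-binomial f g (suc n) = begin
    (D f ⋆ g) n + (f ⋆ D g) n
      ≈⟨ +-cong (⋆-binomial (D f) g n) (⋆-binomial f (D g) n) ⟩
    ∑< (suc n) (λ k → fromℕ (n C k) * (f (suc k) * g (n ∸ k)))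
      + ∑< (suc n) (λ k → fromℕ (n C k) * (f k * g (suc (n ∸ k))))
      ≈⟨ +-congˡ (∑<-cong (suc n) λ { k (s≤s k≤n) → reflexive
           (≡.cong (λ i → fromℕ (n C k) * (f k * g i)) (≡.sym (ℕ.+-∸-assoc 1 k≤n))) }) ⟩
    ∑< (suc n) (λ k → fromℕ (n C k) * (f (suc k) * g (n ∸ k))) + ∑< (suc n) t
      -- The second sum is lengthened by the index n + 1, whose term vanishes with `n C suc n`. Once
      -- its term at 0 is split off, both sums run over the same products and Pascal's rule merges
      -- them.
      ≈⟨ +-congˡ (trans (reflexive (≡.sym (∑<-suc (suc n) t))) extend) ⟨
    ∑< (suc n) (λ k → fromℕ (n C k) * (f (suc k) * g (n ∸ k)))
      + (t 0 + ∑< (suc n) (λ k → fromℕ (n C suc k) * (f (suc k) * g (n ∸ k))))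
      ≈⟨ solve 3 (λ a b c → a :+ (b :+ c) := b :+ (a :+ c)) refl _ _ _ ⟩
    t 0 + (∑< (suc n) (λ k → fromℕ (n C k) * (f (suc k) * g (n ∸ k)))
      + ∑< (suc n) (λ k → fromℕ (n C suc k) * (f (suc k) * g (n ∸ k))))
      ≈⟨ +-congˡ (sym (∑<-+ (suc n) _ _)) ⟩
    fromℕ (suc n C 0) * (f 0 * g (suc n))
      + ∑< (suc n) (λ k → fromℕ (n C k) * (f (suc k) * g (n ∸ k)) + fromℕ (n C suc k) * (f (suc k) * g (n ∸ k)))
      ≈⟨ +-congˡ (∑<-cong′ (suc n) λ k → trans (sym (distribʳ _ _ _)) (*-congʳ (pascal k))) ⟩
    fromℕ (suc n C 0) * (f 0 * g (suc n))
      + ∑< (suc n) (λ k → fromℕ (suc n C suc k) * (f (suc k) * g (n ∸ k)))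
      ≡⟨ ∑<-suc (suc n) _ ⟨
    ∑< (suc (suc n)) (λ k → fromℕ (suc n C k) * (f k * g (suc n ∸ k))) ∎
    where
    t : ℕ → Carrier
    t k = fromℕ (n C k) * (f k * g (suc n ∸ k))
    extend : ∑< (suc (suc n)) t ≈ ∑< (suc n) t
    extend = begin
      ∑< (suc (suc n)) t      ≈⟨ ∑<-last (suc n) t ⟩
      ∑< (suc n) t + t (suc n) ≈⟨ +-congˡ (trans (*-congʳ (reflexive (≡.cong fromℕ (k>n⇒nCk≡0 (ℕ.n<1+n n))))) (zeroˡ _)) ⟩
      ∑< (suc n) t + 0#       ≈⟨ +-identityʳ _ ⟩
      ∑< (suc n) t            ∎
    pascal : ∀ k → fromℕ (n C k) + fromℕ (n C suc k) ≈ fromℕ (suc n C suc k)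
    pascal k = trans (sym (×-homo-+ 1# (n C k) (n C suc k))) (reflexive (≡.cong fromℕ (nCk+nC[k+1]≡[n+1]C[k+1] n k)))

  egf : Series → Ser
  egf f n = fromℕ (n !) * f n

  -- Termwise this is n! = k! (n-k)! C(n,k). It carries the Cauchy products that characterise `Bₙ`
  -- and `Eₙ` over to Hurwitz series.
  egf-⊛ : ∀ f g → egf (f ⊛ g) ≋ egf f ⋆ egf g
  egf-⊛ f g .at n = begin
    fromℕ (n !) * (f ⊛ g) n ≡⟨ ≡.cong (fromℕ (n !) *_) (∑[0⋯n]≡∑< n _) ⟩
    fromℕ (n !) * ∑< (suc n) (λ k → f k * g (n ∸ k)) ≈⟨ ∑<-*ˡ (suc n) _ (λ k → f k * g (n ∸ k)) ⟩
    ∑< (suc n) (λ k → fromℕ (n !) * (f k * g (n ∸ k)))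
      ≈⟨ ∑<-cong (suc n) (λ { k (s≤s k≤n) → step k≤n }) ⟩
    ∑< (suc n) (λ k → fromℕ (n C k) * (egf f k * egf g (n ∸ k))) ≈⟨ ⋆-binomial (egf f) (egf g) n ⟨
    (egf f ⋆ egf g) n ∎
    where
    step : ∀ {k} → k ℕ.≤ n → fromℕ (n !) * (f k * g (n ∸ k)) ≈ fromℕ (n C k) * (egf f k * egf g (n ∸ k))
    step {k} k≤n = begin
      fromℕ (n !) * (f k * g (n ∸ k)) ≡⟨ ≡.cong (λ i → fromℕ i * (f k * g (n ∸ k))) factorials ⟨
      fromℕ (k ! ℕ.* (n ∸ k) ! ℕ.* (n C k)) * (f k * g (n ∸ k))
        ≈⟨ *-congʳ (trans (×1-homo-* (k ! ℕ.* (n ∸ k) !) (n C k)) (*-congʳ (×1-homo-* (k !) ((n ∸ k) !)))) ⟩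
      fromℕ (k !) * fromℕ ((n ∸ k) !) * fromℕ (n C k) * (f k * g (n ∸ k))
        ≈⟨ solve 5 (λ a b c d e → a :* b :* c :* (d :* e) := c :* ((a :* d) :* (b :* e))) refl _ _ _ _ _ ⟩
      fromℕ (n C k) * (egf f k * egf g (n ∸ k)) ∎
      where
      instance _ = k ℕ.!* (n ∸ k) !≢0
      factorials : k ! ℕ.* (n ∸ k) ! ℕ.* (n C k) ≡ n !
      factorials = ≡.trans (≡.cong (k ! ℕ.* (n ∸ k) ! ℕ.*_) (nCk≡n!/k![n-k]! k≤n))
        (m*[n/m]≡n {m = k ! ℕ.* (n ∸ k) !} (k![n∸k]!∣n! k≤n))

-- Exponential series, Appell families and the multiplication formula for their polynomials.

module Exponentials {c₀ ℓ₁ ℓ₂} (ℝ : RealField c₀ ℓ₁ ℓ₂) where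
  open Dedekind ℝ
  open RealArith ℝ
  open FiniteSums ℝ
  open Hurwitz commutativeRing hiding (commutativeRing)
  open Solver using (_:+_; _:*_; _:=_; solve; con)
  open SemiringExp semiring using (^-congˡ)
  open CommutativeSemiringExp commutativeSemiring using (^-distrib-*)
  module H  = CommutativeRing (Hurwitz.commutativeRing commutativeRing)
  module HP = RingProperties H.ring
  open SemiringSolver H.commutativeSemiring public using ()
    renaming (solve to solve₁; con to con₁; _:+_ to _:+₁_; _:*_ to _:*₁_; _:=_ to _:=₁_)
  open SetoidReasoning setoid
  module HR = SetoidReasoning H.setoid

  -- The series e^(xt), its factorials absorbed by the Hurwitz normalisation; `D (ex x)` is
  -- `x • ex x` by definition.
  ex : Carrier → Ser
  ex x n = x ^ n

  ex-cong : ∀ {x y} → x ≈ y → ex x ≋ ex y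
  ex-cong e .at n = ^-congˡ n e

  ex-0 : ex 0# ≋ H.1#
  ex-0 .at zero    = refl
  ex-0 .at (suc n) = zeroˡ _

  ex-+ : ∀ x y → ex x ⋆ ex y ≋ ex (x + y)
  ex-+ x y .at zero    = *-identityˡ _
  ex-+ x y .at (suc n) = begin
    ((x • ex x) ⋆ ex y) n + (ex x ⋆ (y • ex y)) n ≈⟨ +-cong (•-⋆ x (ex x) (ex y) .at n) (⋆-• y (ex x) (ex y) .at n) ⟩
    x * (ex x ⋆ ex y) n + y * (ex x ⋆ ex y) n     ≈⟨ distribʳ _ _ _ ⟨
    (x + y) * (ex x ⋆ ex y) n                     ≈⟨ *-congˡ (ex-+ x y .at n) ⟩
    (x + y) * (x + y) ^ n                         ∎

  var : Ser
  var zero    = 0#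
  var (suc n) = const 1# n

  -- The derivative of t f is f + t f′, whence the induction. At index 0 the truncated `n ∸ 1` is
  -- harmless, since its factor is zero.
  var-⋆ : ∀ f n → (var ⋆ f) n ≈ fromℕ n * f (n ∸ 1)
  var-⋆ f zero    = trans (zeroˡ _) (sym (zeroˡ _))
  var-⋆ f (suc n) = begin
    (const 1# ⋆ f) n + (var ⋆ D f) n     ≈⟨ +-cong (⋆-identityˡ f .at n) (var-⋆ (D f) n) ⟩
    f n + fromℕ n * f (suc (n ∸ 1))      ≈⟨ +-congˡ (reindex n) ⟩
    f n + fromℕ n * f n                  ≈⟨ solve 2 (λ x y → x :+ y :* x := (con (+ 1) :+ y) :* x) refl _ _ ⟩
    (1# + fromℕ n) * f n                 ∎
    where
    reindex : ∀ n → fromℕ n * f (suc (n ∸ 1)) ≈ fromℕ n * f n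
    reindex zero    = trans (zeroˡ _) (sym (zeroˡ _))
    reindex (suc n) = refl

  -- The substitute for division: t has no inverse, but it is not a zero divisor.
  Cancellable : Ser → Set _
  Cancellable k = ∀ f g → k ⋆ f ≋ k ⋆ g → f ≋ g

  *-cancelˡ : ∀ {x y z} → ¬ (x ≈ 0#) → x * y ≈ x * z → y ≈ z
  *-cancelˡ {x} {y} {z} x≉0 e = begin
    y         ≈⟨ /-cancelʳ x≉0 y ⟨
    x * y / x ≈⟨ *-congʳ e ⟩
    x * z / x ≈⟨ /-cancelʳ x≉0 z ⟩
    z         ∎

  const-cancellable : ∀ {x} → ¬ (x ≈ 0#) → Cancellable (const x)
  const-cancellable x≉0 f g e .at n =
    *-cancelˡ x≉0 (trans (sym (const-⋆ _ f .at n)) (trans (e .at n) (const-⋆ _ g .at n)))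

  var-cancellable : Cancellable var
  var-cancellable f g e .at n =
    *-cancelˡ (fromℕ-suc≉0 n) (trans (sym (var-⋆ f (suc n))) (trans (e .at (suc n)) (var-⋆ g (suc n))))

  -- f(t) ↦ f(at)
  dilate : Carrier → Ser → Ser
  dilate a f n = a ^ n * f n

  dilate-cong : ∀ a {f g} → f ≋ g → dilate a f ≋ dilate a g
  dilate-cong a e .at n = *-congˡ (e .at n)

  dilate-⊕ : ∀ a f g → dilate a (f ⊕ g) ≋ dilate a f ⊕ dilate a g
  dilate-⊕ a f g .at n = distribˡ _ _ _

  dilate-⋆ : ∀ a f g → dilate a (f ⋆ g) ≋ dilate a f ⋆ dilate a g
  dilate-⋆ a f g .at zero    = solve 2 (λ x y → con (+ 1) :* (x :* y) := (con (+ 1) :* x) :* (con (+ 1) :* y)) refl _ _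
  dilate-⋆ a f g .at (suc n) = begin
    a ^ suc n * ((D f ⋆ g) n + (f ⋆ D g) n)
      ≈⟨ solve 4 (λ a c x y → a :* c :* (x :+ y) := a :* (c :* x) :+ a :* (c :* y)) refl a (a ^ n) _ _ ⟩
    a * dilate a (D f ⋆ g) n + a * dilate a (f ⋆ D g) n
      ≈⟨ +-cong (*-congˡ (dilate-⋆ a (D f) g .at n)) (*-congˡ (dilate-⋆ a f (D g) .at n)) ⟩
    a * (dilate a (D f) ⋆ dilate a g) n + a * (dilate a f ⋆ dilate a (D g)) n
      ≈⟨ +-cong (•-⋆ a (dilate a (D f)) (dilate a g) .at n) (⋆-• a (dilate a f) (dilate a (D g)) .at n) ⟨
    ((a • dilate a (D f)) ⋆ dilate a g) n + (dilate a f ⋆ (a • dilate a (D g))) n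
      ≈⟨ +-cong (⋆-cong (D-dilate f) H.refl .at n) (⋆-cong (H.refl {dilate a f}) (D-dilate g) .at n) ⟩
    (dilate a f ⋆ dilate a g) (suc n) ∎
    where
    D-dilate : ∀ f → a • dilate a (D f) ≋ D (dilate a f)
    D-dilate f .at n = sym (*-assoc _ _ _)

  dilate-ex : ∀ a x → dilate a (ex x) ≋ ex (a * x)
  dilate-ex a x .at n = sym (^-distrib-* a x n)

  dilate-const : ∀ a x → dilate a (const x) ≋ const x
  dilate-const a x .at zero    = *-identityˡ x
  dilate-const a x .at (suc n) = zeroʳ _

  dilate-var : ∀ a → dilate a var ≋ const a ⋆ var
  dilate-var a = H.trans (mk go) (H.sym (const-⋆ a var))
    where
    go : ∀ n → dilate a var n ≈ a * var n
    go zero          = trans (zeroʳ _) (sym (zeroʳ _))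
    go (suc zero)    = *-congʳ (*-identityʳ a)
    go (suc (suc n)) = trans (zeroʳ _) (sym (zeroʳ _))

  -- Polynomials Pₙ whose exponential generating function is
  -- k(t) e^{xt} / (1 - ε eᵗ): Euler for ε = -1, k = 2 and Bernoulli for ε = 1, k = -t.
  record AppellFamily : Set (c₀ ⊔ ℓ₁) where
    field
      ε             : Carrier
      ε²≈1          : ε * ε ≈ 1#
      k             : Ser
      k-cancellable : Cancellable k
      P             : ℕ → Carrier → Carrier

    gf : Carrier → Ser
    gf x n = P n x

    field
      generating : ∀ x → gf x ≋ k ⋆ ex x ⊕ const ε ⋆ ex 1# ⋆ gf x

    g X : Ser
    g = gf 0#
    X = const ε ⋆ ex 1#

    g-equation : g ≋ k ⊕ X ⋆ g
    g-equation = H.trans (generating 0#) (H.+-congʳ (H.trans (H.*-congˡ ex-0) (H.*-identityʳ k)))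

    -- Times k, both sides equal (1 - X) ⋆ g ⋆ `gf x`, by the equation of g and by that of `gf x`.
    -- The X-term is added to both sides instead of subtracted, and only k is cancelled, because 1 -
    -- X is not invertible when ε = 1.
    gf≋ : ∀ x → gf x ≋ ex x ⋆ g
    gf≋ x = k-cancellable _ _ (HP.+-cancelʳ (X ⋆ (g ⋆ gf x)) _ _ (HR.begin
      k ⋆ gf x ⊕ X ⋆ (g ⋆ gf x)        HR.≈⟨ solve₁ 4 (λ k x g p → k :*₁ p :+₁ x :*₁ (g :*₁ p) :=₁ (k :+₁ x :*₁ g) :*₁ p) H.refl _ _ _ _ ⟩
      (k ⊕ X ⋆ g) ⋆ gf x               HR.≈⟨ H.*-congʳ g-equation ⟨
      g ⋆ gf x                         HR.≈⟨ H.*-congˡ (generating x) ⟩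
      g ⋆ (k ⋆ ex x ⊕ X ⋆ gf x)        HR.≈⟨ solve₁ 5 (λ k x g p e → g :*₁ (k :*₁ e :+₁ x :*₁ p) :=₁ k :*₁ (e :*₁ g) :+₁ x :*₁ (g :*₁ p)) H.refl _ _ _ _ _ ⟩
      k ⋆ (ex x ⋆ g) ⊕ X ⋆ (g ⋆ gf x)  HR.∎))

    P-cong : ∀ n {x y} → x ≈ y → P n x ≈ P n y
    P-cong n e = H.trans (gf≋ _) (H.trans (H.*-congʳ (ex-cong e)) (H.sym (gf≋ _))) .at n

    -- `geo m` is 1 + X + ... + X^(m-1), and `pow m` is X^m in the closed form ε^m e^(mt).
    geo pow : ℕ → Ser
    geo zero    = H.0#
    geo (suc m) = H.1# ⊕ X ⋆ geo m
    pow m = const (ε ^ m) ⋆ ex (fromℕ m)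

    pow-suc : ∀ m → pow (suc m) ≋ X ⋆ pow m
    pow-suc m = HR.begin
      const (ε * ε ^ m) ⋆ ex (1# + fromℕ m)               HR.≈⟨ H.*-cong (const-* ε (ε ^ m)) (H.sym (ex-+ 1# (fromℕ m))) ⟩
      (const ε ⋆ const (ε ^ m)) ⋆ (ex 1# ⋆ ex (fromℕ m))  HR.≈⟨ solve₁ 4 (λ a b c d → (a :*₁ b) :*₁ (c :*₁ d) :=₁ (a :*₁ c) :*₁ (b :*₁ d)) H.refl _ _ _ _ ⟩
      X ⋆ pow m                                           HR.∎

    -- Both sides are 1 + X + ... + X^m: the identity (1 - X) geo m = 1 - X^m without subtraction.
    geo-sum : ∀ m → geo m ⊕ pow m ≋ H.1# ⊕ X ⋆ geo m
    geo-sum zero    = HR.begin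
      H.0# ⊕ H.1# ⋆ ex 0#  HR.≈⟨ H.trans (H.+-identityˡ _) (H.trans (H.*-identityˡ _) ex-0) ⟩
      H.1#                 HR.≈⟨ H.+-identityʳ _ ⟨
      H.1# ⊕ H.0#          HR.≈⟨ H.+-congˡ (H.zeroʳ X) ⟨
      H.1# ⊕ X ⋆ H.0#      HR.∎
    geo-sum (suc m) = HR.begin
      H.1# ⊕ X ⋆ geo m ⊕ pow (suc m)  HR.≈⟨ H.+-congˡ (pow-suc m) ⟩
      H.1# ⊕ X ⋆ geo m ⊕ X ⋆ pow m    HR.≈⟨ H.trans (H.+-assoc _ _ _) (H.+-congˡ (H.sym (H.distribˡ _ _ _))) ⟩
      H.1# ⊕ X ⋆ (geo m ⊕ pow m)      HR.≈⟨ H.+-congˡ (H.*-congˡ (geo-sum m)) ⟩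
      H.1# ⊕ X ⋆ (H.1# ⊕ X ⋆ geo m)   HR.∎

    -- X^l e^(yt) = ε^l e^((y+l)t). The induction moves one factor X at a time into y, which is why
    -- y is general.
    geo-⋆ : ∀ f m y n → ((geo m ⋆ ex y) ⋆ f) n ≈ ∑< m (λ l → ε ^ l * (ex (y + fromℕ l) ⋆ f) n)
    geo-⋆ f zero    y n = trans (H.trans (H.*-congʳ (H.zeroˡ _)) (H.zeroˡ f) .at n) (reflexive (≡.sym (∑<-zero _)))
    geo-⋆ f (suc m) y n = begin
      (((H.1# ⊕ X ⋆ geo m) ⋆ ex y) ⋆ f) n
        ≈⟨ solve₁ 5 (λ e u g y f → (con₁ 1 :+₁ (e :*₁ u) :*₁ g) :*₁ y :*₁ f :=₁ y :*₁ f :+₁ e :*₁ ((g :*₁ (y :*₁ u)) :*₁ f)) H.refl (const ε) (ex 1#) (geo m) (ex y) f .at n ⟩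
      (ex y ⋆ f) n + (const ε ⋆ ((geo m ⋆ (ex y ⋆ ex 1#)) ⋆ f)) n
        ≈⟨ +-congˡ (const-⋆ ε _ .at n) ⟩
      (ex y ⋆ f) n + ε * ((geo m ⋆ (ex y ⋆ ex 1#)) ⋆ f) n
        ≈⟨ +-cong (H.*-congʳ (ex-cong (sym (+-identityʳ y))) .at n)
             (*-congˡ (trans (H.*-congʳ (H.*-congˡ (ex-+ y 1#)) .at n) (geo-⋆ f m (y + 1#) n))) ⟩
      (ex (y + 0#) ⋆ f) n + ε * ∑< m (λ l → ε ^ l * (ex (y + 1# + fromℕ l) ⋆ f) n)
        ≈⟨ +-cong (sym (*-identityˡ _)) (trans (∑<-*ˡ m ε _) (∑<-cong′ m λ l →
             trans (sym (*-assoc _ _ _)) (*-congˡ (H.*-congʳ (ex-cong (+-assoc y 1# (fromℕ l))) .at n)))) ⟩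
      1# * (ex (y + 0#) ⋆ f) n + ∑< m (λ l → ε ^ suc l * (ex (y + fromℕ (suc l)) ⋆ f) n)
        ≡⟨ ∑<-suc m _ ⟨
      ∑< (suc m) (λ l → ε ^ l * (ex (y + fromℕ l) ⋆ f) n) ∎

    module _ (a : ℕ) .{{_ : NonZero a}} (εᵃ≈ε : ε ^ a ≈ ε)
             (α : Carrier) (dilate-k : dilate (fromℕ a) k ≋ const α ⋆ k) where

      A : Ser
      A = dilate (fromℕ a) g

      -- Dilation sends X = ε eᵗ to ε e^(at), and it is `εᵃ≈ε` that turns this into X^a, a power of
      -- the original X.
      A-equation : A ≋ const α ⋆ k ⊕ pow a ⋆ A
      A-equation = HR.begin
        dilate â g                        HR.≈⟨ dilate-cong â g-equation ⟩
        dilate â (k ⊕ X ⋆ g)              HR.≈⟨ dilate-⊕ â k (X ⋆ g) ⟩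
        dilate â k ⊕ dilate â (X ⋆ g)     HR.≈⟨ H.+-cong dilate-k (dilate-⋆ â X g) ⟩
        const α ⋆ k ⊕ dilate â X ⋆ A      HR.≈⟨ H.+-congˡ (H.*-congʳ (dilate-⋆ â (const ε) (ex 1#))) ⟩
        const α ⋆ k ⊕ (dilate â (const ε) ⋆ dilate â (ex 1#)) ⋆ A
          HR.≈⟨ H.+-congˡ (H.*-congʳ (H.*-cong (H.trans (dilate-const â ε) (const-cong (sym εᵃ≈ε)))
                (H.trans (dilate-ex â 1#) (ex-cong (*-identityʳ â))))) ⟩
        const α ⋆ k ⊕ pow a ⋆ A           HR.∎
        where â = fromℕ a

      -- As fractions, A = αk/(1 - X^a) and `geo a` = (1 - X^a)/(1 - X), so their product is αk/(1 -
      -- X) = αg. The chain is this computation with the denominators multiplied out, leaving k as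
      -- the only factor to cancel.
      geo-⋆-A : geo a ⋆ A ≋ const α ⋆ g
      geo-⋆-A = k-cancellable _ _ (HP.+-cancelʳ (X ⋆ (g ⋆ (G ⋆ A)) ⊕ pow a ⋆ (g ⋆ A)) _ _ (HR.begin
        k ⋆ (G ⋆ A) ⊕ (X ⋆ (g ⋆ (G ⋆ A)) ⊕ pow a ⋆ (g ⋆ A))
          HR.≈⟨ solve₁ 6 (λ k X g G A p → k :*₁ (G :*₁ A) :+₁ (X :*₁ (g :*₁ (G :*₁ A)) :+₁ p :*₁ (g :*₁ A))
              :=₁ (k :+₁ X :*₁ g) :*₁ (G :*₁ A) :+₁ p :*₁ (g :*₁ A)) H.refl _ _ _ _ _ _ ⟩
        (k ⊕ X ⋆ g) ⋆ (G ⋆ A) ⊕ pow a ⋆ (g ⋆ A)  HR.≈⟨ H.+-congʳ (H.*-congʳ g-equation) ⟨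
        g ⋆ (G ⋆ A) ⊕ pow a ⋆ (g ⋆ A)
          HR.≈⟨ solve₁ 4 (λ g G A p → g :*₁ (G :*₁ A) :+₁ p :*₁ (g :*₁ A) :=₁ (G :+₁ p) :*₁ (g :*₁ A)) H.refl _ _ _ _ ⟩
        (G ⊕ pow a) ⋆ (g ⋆ A)                    HR.≈⟨ H.*-congʳ (geo-sum a) ⟩
        (H.1# ⊕ X ⋆ G) ⋆ (g ⋆ A)
          HR.≈⟨ solve₁ 4 (λ X G g A → (con₁ 1 :+₁ X :*₁ G) :*₁ (g :*₁ A) :=₁ X :*₁ (g :*₁ (G :*₁ A)) :+₁ g :*₁ A) H.refl _ _ _ _ ⟩
        X ⋆ (g ⋆ (G ⋆ A)) ⊕ g ⋆ A                HR.≈⟨ H.+-congˡ (H.*-congˡ A-equation) ⟩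
        X ⋆ (g ⋆ (G ⋆ A)) ⊕ g ⋆ (const α ⋆ k ⊕ pow a ⋆ A)
          HR.≈⟨ solve₁ 6 (λ s g α k p A → s :+₁ g :*₁ (α :*₁ k :+₁ p :*₁ A) :=₁ k :*₁ (α :*₁ g) :+₁ (s :+₁ p :*₁ (g :*₁ A))) H.refl _ _ _ _ _ _ ⟩
        k ⋆ (const α ⋆ g) ⊕ (X ⋆ (g ⋆ (G ⋆ A)) ⊕ pow a ⋆ (g ⋆ A)) HR.∎))
        where G = geo a

      -- Coefficients of `geo-⋆-A` times e^(ut). The scalar α records how the numerator k dilates:
      -- it is 1 for k = 2 and a for k = -t, hence the extra factor in the Bernoulli formula.
      P-multiplication : ∀ n u → α * P n u ≈ fromℕ a ^ n * ∑< a (λ l → ε ^ l * P n ((u + fromℕ l) / fromℕ a))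
      P-multiplication n u = begin
        α * P n u                    ≈⟨ *-congˡ (gf≋ u .at n) ⟩
        α * (ex u ⋆ g) n             ≈⟨ const-⋆ α _ .at n ⟨
        (const α ⋆ (ex u ⋆ g)) n     ≈⟨ solve₁ 3 (λ x y z → x :*₁ (y :*₁ z) :=₁ y :*₁ (x :*₁ z)) H.refl (const α) (ex u) g .at n ⟩
        (ex u ⋆ (const α ⋆ g)) n     ≈⟨ H.*-congˡ {ex u} (H.sym geo-⋆-A) .at n ⟩
        (ex u ⋆ (geo a ⋆ A)) n       ≈⟨ solve₁ 3 (λ x y z → x :*₁ (y :*₁ z) :=₁ (y :*₁ x) :*₁ z) H.refl (ex u) (geo a) A .at n ⟩
        ((geo a ⋆ ex u) ⋆ A) n       ≈⟨ geo-⋆ A a u n ⟩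
        ∑< a (λ l → ε ^ l * (ex (u + fromℕ l) ⋆ A) n) ≈⟨ ∑<-cong′ a (λ l → trans (*-congˡ (term l))
              (solve 3 (λ x y z → x :* (y :* z) := y :* (x :* z)) refl _ _ _)) ⟩
        ∑< a (λ l → fromℕ a ^ n * (ε ^ l * P n ((u + fromℕ l) / fromℕ a))) ≈⟨ ∑<-*ˡ a _ _ ⟨
        fromℕ a ^ n * ∑< a (λ l → ε ^ l * P n ((u + fromℕ l) / fromℕ a)) ∎
        where
        term : ∀ l → (ex (u + fromℕ l) ⋆ A) n ≈ fromℕ a ^ n * P n ((u + fromℕ l) / fromℕ a)
        term l = begin
          (ex (u + fromℕ l) ⋆ A) n   ≈⟨ H.*-congʳ {A} (ex-cong (/-cancelˡ (fromℕ≉0 a) (u + fromℕ l))) .at n ⟨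
          (ex (fromℕ a * w) ⋆ A) n   ≈⟨ H.*-congʳ {A} (dilate-ex (fromℕ a) w) .at n ⟨
          (dilate (fromℕ a) (ex w) ⋆ A) n ≈⟨ dilate-⋆ (fromℕ a) (ex w) g .at n ⟨
          dilate (fromℕ a) (ex w ⋆ g) n ≈⟨ *-congˡ (gf≋ w .at n) ⟨
          fromℕ a ^ n * P n w        ∎
          where w = (u + fromℕ l) / fromℕ a

-- Quasi-periodic extension from [0,1), and the multiplication formula for it.

module Periodic {c₀ ℓ₁ ℓ₂} (ℝ : RealField c₀ ℓ₁ ℓ₂) where
  open Dedekind ℝ
  open RealArith ℝ
  open FiniteSums ℝ
  open Exponentials ℝ
  open Hurwitz commutativeRing hiding (commutativeRing)
  open Solver using (_:+_; _:*_; _:-_; :-_; _:=_; solve; con)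
  open RingProperties ring
  open IsDecTotalOrder isDecTotalOrder
    using (total; antisym; ≤-respˡ-≈; ≤-respʳ-≈)
    renaming (trans to ≤-trans)
  open SetoidReasoning setoid

  x≤y⇒0≤y-x : ∀ {x y} → x ≤ y → 0# ≤ y - x
  x≤y⇒0≤y-x {x} x≤y = ≤-respˡ-≈ (-‿inverseʳ x) (+-monoˡ-≤ (- x) x≤y)

  0≤y-x⇒x≤y : ∀ {x y} → 0# ≤ y - x → x ≤ y
  0≤y-x⇒x≤y {x} {y} p = ≤-respˡ-≈ (+-identityˡ x) (≤-respʳ-≈ (x-y+y≈x y x) (+-monoˡ-≤ x p))

  *-monoˡ-≤ : ∀ {z x y} → 0# ≤ z → x ≤ y → z * x ≤ z * y
  *-monoˡ-≤ {z} {x} {y} 0≤z x≤y = 0≤y-x⇒x≤y (≤-respʳ-≈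
    (solve 3 (λ x y z → z :* (y :- x) := z :* y :- z :* x) refl x y z)
    (*-nonNegative 0≤z (x≤y⇒0≤y-x x≤y)))

  fromℕ-mono-≤ : ∀ {m n} → m ℕ.≤ n → fromℕ m ≤ fromℕ n
  fromℕ-mono-≤ {n = n} z≤n = 0≤fromℕ n
  fromℕ-mono-≤ (s≤s p)     = +-monoʳ-≤ 1# (fromℕ-mono-≤ p)

  0≤fromℕ⁻¹ : ∀ n .{{_ : NonZero n}} → 0# ≤ fromℕ n ⁻¹
  0≤fromℕ⁻¹ n with total 0# (fromℕ n ⁻¹)
  ... | inj₁ p = p
  ... | inj₂ p = ⊥-elim (1≉0 (antisym 1≤0 0≤1))
    where
    1≤0 : 1# ≤ 0#
    1≤0 = ≤-respˡ-≈ (⁻¹-inverseʳ (fromℕ≉0 n)) (≤-respʳ-≈ (zeroʳ _) (*-monoˡ-≤ (0≤fromℕ n) p))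

  ⌊⌋-cong : ∀ {x y} → x ≈ y → ⌊ x ⌋ ≡ ⌊ y ⌋
  ⌊⌋-cong {x} {y} e = ℤ.≤-antisym
    (⌊⌋-greatest y _ (≤-respʳ-≈ e (⌊⌋-lowerBound x)))
    (⌊⌋-greatest x _ (≤-respʳ-≈ (sym e) (⌊⌋-lowerBound y)))

  frac : Carrier → Carrier
  frac x = x - fromℤ ⌊ x ⌋

  0≤frac : ∀ x → 0# ≤ frac x
  0≤frac x = x≤y⇒0≤y-x (⌊⌋-lowerBound x)

  frac≱1 : ∀ x → ¬ (1# ≤ frac x)
  frac≱1 x 1≤fx = ℤ.<-irrefl ≡.refl (ℤ.suc[i]≤j⇒i<j
    (⌊⌋-greatest x (+ 1 ℤ.+ ⌊ x ⌋) (≤-respˡ-≈ (sym left) (≤-respʳ-≈ (x-y+y≈x x _) (+-monoˡ-≤ (fromℤ ⌊ x ⌋) 1≤fx)))))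
    where
    left : fromℤ (+ 1 ℤ.+ ⌊ x ⌋) ≈ 1# + fromℤ ⌊ x ⌋
    left = trans (fromℤ-homo-+ (+ 1) ⌊ x ⌋) (+-congʳ (+-identityʳ 1#))

  frac+⌊⌋ : ∀ x → frac x + fromℤ ⌊ x ⌋ ≈ x
  frac+⌊⌋ x = x-y+y≈x x _

  module Periodization (F : AppellFamily) where
    open AppellFamily F

    ε≉0 : ¬ (ε ≈ 0#)
    ε≉0 e = 1≉0 (trans (sym ε²≈1) (trans (*-congʳ e) (zeroˡ ε)))

    -- For ε = -1 this unfolds to `𝓔`; for ε = 1 it is `𝓑` up to a factor `1# ^ℤ ⌊ x ⌋`.
    𝓟 : ℕ → Carrier → Carrier
    𝓟 n x = ε ^ℤ ⌊ x ⌋ * P n (frac x)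

    𝓟-cong : ∀ n {x y} → x ≈ y → 𝓟 n x ≈ 𝓟 n y
    𝓟-cong n {x} {y} e = *-cong (reflexive (≡.cong (ε ^ℤ_) (⌊⌋-cong e)))
      (P-cong n (+-cong e (-‿cong (reflexive (≡.cong fromℤ (⌊⌋-cong e))))))

    𝓟-shift : ∀ n x m → 𝓟 n (x + fromℤ m) ≈ ε ^ℤ m * 𝓟 n x
    𝓟-shift n x m = begin
      ε ^ℤ ⌊ x + fromℤ m ⌋ * P n (x + fromℤ m - fromℤ ⌊ x + fromℤ m ⌋)
        ≡⟨ ≡.cong (λ i → ε ^ℤ i * P n (x + fromℤ m - fromℤ i)) (⌊⌋-shift x m) ⟩
      ε ^ℤ (⌊ x ⌋ ℤ.+ m) * P n (x + fromℤ m - fromℤ (⌊ x ⌋ ℤ.+ m))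
        ≈⟨ *-cong (^ℤ-homo-* ε≉0 ⌊ x ⌋ m) (P-cong n (trans (+-congˡ (-‿cong (fromℤ-homo-+ ⌊ x ⌋ m)))
             (solve 3 (λ x m l → x :+ m :- (l :+ m) := x :- l) refl x (fromℤ m) (fromℤ ⌊ x ⌋)))) ⟩
      ε ^ℤ ⌊ x ⌋ * ε ^ℤ m * P n (frac x)
        ≈⟨ solve 3 (λ a b c → a :* b :* c := b :* (a :* c)) refl _ _ _ ⟩
      ε ^ℤ m * 𝓟 n x ∎

    𝓟-unit : ∀ n {x} → 0# ≤ x → ¬ (1# ≤ x) → 𝓟 n x ≈ P n x
    𝓟-unit n {x} 0≤x 1≰x = begin
      ε ^ℤ ⌊ x ⌋ * P n (x - fromℤ ⌊ x ⌋) ≡⟨ ≡.cong (λ i → ε ^ℤ i * P n (x - fromℤ i)) (⌊⌋-unit 0≤x 1≰x) ⟩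
      1# * P n (x - 0#)                  ≈⟨ *-identityˡ _ ⟩
      P n (x - 0#)                       ≈⟨ P-cong n (solve 1 (λ x → x :- con (+ 0) := x) refl x) ⟩
      P n x                              ∎

    module _ (a : ℕ) .{{_ : NonZero a}} (εᵃ≈ε : ε ^ a ≈ ε) (n : ℕ) where
      private
        â : Carrier
        â = fromℕ a

      -- The right-hand side of the multiplication formula. It is shown to pick up ε under u ↦ u +
      -- 1, as `𝓟` does, so that the formula need only be checked on [0,1).
      T : Carrier → Carrier
      T u = ∑< a λ l → ε ^ l * 𝓟 n ((u + fromℕ l) / â)

      T-cong : ∀ {u v} → u ≈ v → T u ≈ T v
      T-cong e = ∑<-cong′ a λ l → *-congˡ (𝓟-cong n (*-congʳ (+-congʳ e)))

      -- A unit step of u rotates the a terms cyclically. The term that wraps around carries ε^a = ε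
      -- from its sign and another ε from moving the argument of `𝓟` by 1, and ε² = 1.
      T-suc : ∀ u → T (u + 1#) ≈ ε * T u
      T-suc u = begin
        T (u + 1#) ≈⟨ ∑<-cong′ a (λ l → trans (*-congˡ (𝓟-cong n (*-congʳ (+-assoc u 1# (fromℕ l))))) (ε-pull l)) ⟩
        ∑< a (λ l → ε * t (suc l)) ≈⟨ ∑<-*ˡ a ε _ ⟨
        ε * ∑< a (λ l → t (suc l)) ≈⟨ *-congˡ cyclic ⟩
        ε * ∑< a t ∎
        where
        t : ℕ → Carrier
        t l = ε ^ l * 𝓟 n ((u + fromℕ l) / â)
        ε-pull : ∀ l → ε ^ l * 𝓟 n ((u + fromℕ (suc l)) / â) ≈ ε * t (suc l)
        ε-pull l = sym (begin
          ε * (ε * ε ^ l * 𝓟 n _)   ≈⟨ solve 3 (λ e p x → e :* (e :* p :* x) := (e :* e) :* (p :* x)) refl _ _ _ ⟩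
          (ε * ε) * (ε ^ l * 𝓟 n _) ≈⟨ trans (*-congʳ ε²≈1) (*-identityˡ _) ⟩
          ε ^ l * 𝓟 n _             ∎)
        t-last : t a ≈ t 0
        t-last = begin
          ε ^ a * 𝓟 n ((u + â) / â)            ≈⟨ *-cong εᵃ≈ε (𝓟-cong n wrap) ⟩
          ε * 𝓟 n ((u + 0#) / â + fromℤ (+ 1)) ≈⟨ *-congˡ (𝓟-shift n _ (+ 1)) ⟩
          ε * (ε * 1# * 𝓟 n ((u + 0#) / â))    ≈⟨ solve 2 (λ e x → e :* (e :* con (+ 1) :* x) := (e :* e) :* x) refl _ _ ⟩
          ε * ε * 𝓟 n ((u + 0#) / â)           ≈⟨ *-congʳ ε²≈1 ⟩
          1# * 𝓟 n ((u + 0#) / â)              ∎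
          where
          wrap : (u + â) / â ≈ (u + 0#) / â + fromℤ (+ 1)
          wrap = begin
            (u + â) * â ⁻¹                 ≈⟨ solve 3 (λ u a b → (u :+ a) :* b := (u :+ con (+ 0)) :* b :+ a :* b) refl u â (â ⁻¹) ⟩
            (u + 0#) * â ⁻¹ + â * â ⁻¹     ≈⟨ +-congˡ (trans (⁻¹-inverseʳ (fromℕ≉0 a)) (sym (+-identityʳ 1#))) ⟩
            (u + 0#) / â + fromℤ (+ 1)     ∎
        cyclic : ∑< a (λ l → t (suc l)) ≈ ∑< a t
        cyclic = +-cancelˡ (t 0) _ _ (begin
          t 0 + ∑< a (λ l → t (suc l)) ≡⟨ ∑<-suc a t ⟨
          ∑< (suc a) t                 ≈⟨ ∑<-last a t ⟩
          ∑< a t + t a                 ≈⟨ trans (+-congˡ t-last) (+-comm _ _) ⟩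
          t 0 + ∑< a t                 ∎)

      T-+ℕ : ∀ u m → T (u + fromℕ m) ≈ ε ^ m * T u
      T-+ℕ u zero    = trans (T-cong (+-identityʳ u)) (sym (*-identityˡ _))
      T-+ℕ u (suc m) = begin
        T (u + (1# + fromℕ m)) ≈⟨ T-cong (solve 2 (λ u m → u :+ (con (+ 1) :+ m) := u :+ m :+ con (+ 1)) refl u (fromℕ m)) ⟩
        T (u + fromℕ m + 1#)   ≈⟨ T-suc (u + fromℕ m) ⟩
        ε * T (u + fromℕ m)    ≈⟨ *-congˡ (T-+ℕ u m) ⟩
        ε * (ε ^ m * T u)      ≈⟨ *-assoc _ _ _ ⟨
        ε * ε ^ m * T u        ∎

      T-+ℤ : ∀ u i → T (u + fromℤ i) ≈ ε ^ℤ i * T u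
      T-+ℤ u (+ m)    = T-+ℕ u m
      T-+ℤ u -[1+ m ] = begin
        T v                                       ≈⟨ *-identityˡ _ ⟨
        ε ^ℤ 0ℤ * T v                             ≡⟨ ≡.cong (λ i → ε ^ℤ i * T v) (ℤ.+-inverseˡ (+ suc m)) ⟨
        ε ^ℤ (-[1+ m ] ℤ.+ + suc m) * T v         ≈⟨ *-congʳ (^ℤ-homo-* ε≉0 -[1+ m ] (+ suc m)) ⟩
        ε ^ℤ -[1+ m ] * ε ^ suc m * T v           ≈⟨ *-assoc _ _ _ ⟩
        ε ^ℤ -[1+ m ] * (ε ^ suc m * T v)         ≈⟨ *-congˡ (T-+ℕ v (suc m)) ⟨
        ε ^ℤ -[1+ m ] * T (v + fromℕ (suc m))     ≈⟨ *-congˡ (T-cong (x-y+y≈x u (fromℕ (suc m)))) ⟩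
        ε ^ℤ -[1+ m ] * T u                       ∎
        where v = u + fromℤ -[1+ m ]

      unit-fraction : ∀ {u l} → 0# ≤ u → ¬ (1# ≤ u) → l ℕ.< a → 𝓟 n ((u + fromℕ l) / â) ≈ P n ((u + fromℕ l) / â)
      unit-fraction {u} {l} 0≤u 1≰u l<a = 𝓟-unit n nonNeg not≥1
        where
        nonNeg : 0# ≤ (u + fromℕ l) / â
        nonNeg = *-nonNegative (≤-trans (≤-respʳ-≈ (sym (+-identityʳ u)) 0≤u) (+-monoʳ-≤ u (0≤fromℕ l))) (0≤fromℕ⁻¹ a)
        not≥1 : ¬ (1# ≤ (u + fromℕ l) / â)
        not≥1 p = 1≰u (≤-respˡ-≈ (x+y-y≈x 1# (fromℕ l)) (≤-respʳ-≈ (x+y-y≈x u (fromℕ l)) (+-monoˡ-≤ (- fromℕ l)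
          (≤-trans (fromℕ-mono-≤ l<a) (≤-respˡ-≈ (*-identityʳ â) (≤-respʳ-≈ (/-cancelˡ (fromℕ≉0 a) _) (*-monoˡ-≤ (0≤fromℕ a) p)))))))

      -- On the fractional part f of u every argument (f + l)/a with l < a stays in [0,1), where `𝓟`
      -- is the polynomial, so `P-multiplication` applies; `T-+ℤ` then restores the integer part.
      𝓟-multiplication : (α : Carrier) → dilate â k ≋ const α ⋆ k → ∀ u → α * 𝓟 n u ≈ â ^ n * T u
      𝓟-multiplication α dilate-k u = begin
        α * (ε ^ℤ ⌊ u ⌋ * P n f)  ≈⟨ solve 3 (λ a e p → a :* (e :* p) := e :* (a :* p)) refl _ _ _ ⟩
        ε ^ℤ ⌊ u ⌋ * (α * P n f)  ≈⟨ *-congˡ (P-multiplication a εᵃ≈ε α dilate-k n f) ⟩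
        ε ^ℤ ⌊ u ⌋ * (â ^ n * ∑< a (λ l → ε ^ l * P n ((f + fromℕ l) / â)))
          ≈⟨ *-congˡ (*-congˡ (∑<-cong a λ l l<a → *-congˡ (unit-fraction (0≤frac u) (frac≱1 u) l<a))) ⟨
        ε ^ℤ ⌊ u ⌋ * (â ^ n * T f) ≈⟨ solve 3 (λ e a t → e :* (a :* t) := a :* (e :* t)) refl _ _ _ ⟩
        â ^ n * (ε ^ℤ ⌊ u ⌋ * T f) ≈⟨ *-congˡ (T-+ℤ f ⌊ u ⌋) ⟨
        â ^ n * T (f + fromℤ ⌊ u ⌋) ≈⟨ *-congˡ (T-cong (frac+⌊⌋ u)) ⟩
        â ^ n * T u                ∎
        where f = frac u

-- With e₁ = 2/(1+U), e₁₂ = 2/(1+UV) and b = v/(V-1), these are the partial fraction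
-- decompositions of 1/((1+U)(V-1)) over the common denominator 1+UV.
module PartialFractions {c ℓ} (R : CommutativeRing c ℓ) where
  open CommutativeRing R
  open SemiringSolver commutativeSemiring
  open SetoidReasoning setoid

  module _ {two U V e₁ e₁₂ b v}
           (e₁-eq : e₁ + U * e₁ ≈ two) (e₁₂-eq : e₁₂ + U * V * e₁₂ ≈ two)
           (b-eq : V * b ≈ b + v) where

    -- Over the denominator (1+U)(V-1)(1+UV) this is (1+UV) + (V-1) = V(1+U).
    partialFractions₀ : two * (e₁ * b) + v * (e₁₂ * e₁) ≈ two * (e₁₂ * (V * b))
    partialFractions₀ = begin
      two * (e₁ * b) + v * (e₁₂ * e₁) ≈⟨ +-congʳ (*-congʳ e₁₂-eq) ⟨
      (e₁₂ + U * V * e₁₂) * (e₁ * b) + v * (e₁₂ * e₁)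
        ≈⟨ solve 6 (λ U V e₁ e₁₂ b v → (e₁₂ :+ U :* V :* e₁₂) :* (e₁ :* b) :+ v :* (e₁₂ :* e₁)
             := e₁₂ :* e₁ :* (b :+ v) :+ U :* e₁₂ :* e₁ :* (V :* b)) refl U V e₁ e₁₂ b v ⟩
      e₁₂ * e₁ * (b + v) + U * e₁₂ * e₁ * (V * b) ≈⟨ +-congʳ (*-congˡ b-eq) ⟨
      e₁₂ * e₁ * (V * b) + U * e₁₂ * e₁ * (V * b)
        ≈⟨ solve 4 (λ U e₁ e₁₂ Vb → e₁₂ :* e₁ :* Vb :+ U :* e₁₂ :* e₁ :* Vb
             := (e₁ :+ U :* e₁) :* (e₁₂ :* Vb)) refl U e₁ e₁₂ (V * b) ⟩
      (e₁ + U * e₁) * (e₁₂ * (V * b)) ≈⟨ *-congʳ e₁-eq ⟩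
      two * (e₁₂ * (V * b)) ∎

    -- Over the same denominator, 1+UV = U(V-1) + (1+U).
    partialFractions₁ : two * (e₁ * b) ≈ v * (U * (e₁₂ * e₁)) + two * (e₁₂ * b)
    partialFractions₁ = begin
      two * (e₁ * b) ≈⟨ *-congʳ e₁₂-eq ⟨
      (e₁₂ + U * V * e₁₂) * (e₁ * b)
        ≈⟨ solve 5 (λ U V e₁ e₁₂ b → (e₁₂ :+ U :* V :* e₁₂) :* (e₁ :* b)
             := e₁₂ :* e₁ :* b :+ U :* e₁₂ :* e₁ :* (V :* b)) refl U V e₁ e₁₂ b ⟩
      e₁₂ * e₁ * b + U * e₁₂ * e₁ * (V * b) ≈⟨ +-congˡ (*-congˡ b-eq) ⟩
      e₁₂ * e₁ * b + U * e₁₂ * e₁ * (b + v)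
        ≈⟨ solve 5 (λ U e₁ e₁₂ b v → e₁₂ :* e₁ :* b :+ U :* e₁₂ :* e₁ :* (b :+ v)
             := v :* (U :* (e₁₂ :* e₁)) :+ (e₁ :+ U :* e₁) :* (e₁₂ :* b)) refl U e₁ e₁₂ b v ⟩
      v * (U * (e₁₂ * e₁)) + (e₁ + U * e₁) * (e₁₂ * b) ≈⟨ +-congˡ (*-congʳ e₁-eq) ⟩
      v * (U * (e₁₂ * e₁)) + two * (e₁₂ * b) ∎

-- The Euler and Bernoulli families, and reflection of Bernoulli polynomials.

module EulerBernoulli {c₀ ℓ₁ ℓ₂} (ℝ : RealField c₀ ℓ₁ ℓ₂) where
  open Dedekind ℝ
  open RealArith ℝ
  open FiniteSums ℝ
  open HurwitzReal ℝ
  open Exponentials ℝ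
  open Periodic ℝ
  open Hurwitz commutativeRing hiding (commutativeRing)
  open Solver using (_:+_; _:*_; _:-_; :-_; _:=_; solve; con)
  open RingProperties ring
  open SemiringMult semiring using (×1-homo-*)
  open SemiringExp semiring using (^-congˡ)
  open SetoidReasoning setoid

  two : Ser
  two = const (fromℕ 2)

  egf-expSeries : ∀ x → egf (expSeries x) ≋ ex x
  egf-expSeries x .at n = /-cancelˡ (n!≉0 n) _

  egf-const : ∀ x → egf (constSeries x) ≋ const x
  egf-const x .at zero    = trans (*-congʳ (+-identityʳ 1#)) (*-identityˡ x)
  egf-const x .at (suc n) = zeroʳ _

  Es Bs : Carrier → Ser
  Es x n = Eₙ n x
  Bs x n = Bₙ n x

  Es-equation : ∀ x → (ex 1# ⊕ H.1#) ⋆ Es x ≋ two ⋆ ex x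
  Es-equation x = HR.begin
    (ex 1# ⊕ H.1#) ⋆ Es x HR.≈⟨ ⋆-cong divisor (mk λ n → /-cancelˡ (n!≉0 n) _) ⟨
    egf expSeries+1 ⋆ egf (λ n → Eₙ n x / fromℕ (n !)) HR.≈⟨ egf-⊛ expSeries+1 _ ⟨
    egf (expSeries+1 ⊛ λ n → Eₙ n x / fromℕ (n !)) HR.≈⟨ mk (λ n → *-congˡ (Eₙ-generating x n)) ⟩
    egf (λ n → fromℕ 2 * expSeries x n) HR.≈⟨ mk (λ n → trans (solve 3 (λ a b c → a :* (b :* c) := b :* (a :* c)) refl _ _ _) (*-congˡ (egf-expSeries x .at n))) ⟩
    fromℕ 2 • ex x HR.≈⟨ const-⋆ (fromℕ 2) (ex x) ⟨
    two ⋆ ex x HR.∎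
    where
    divisor : egf expSeries+1 ≋ ex 1# ⊕ H.1#
    divisor .at n = trans (distribˡ _ _ _) (+-cong (egf-expSeries 1# .at n) (egf-const 1# .at n))

  Bs-equation : ∀ x → ex 1# ⋆ Bs x ≋ Bs x ⊕ var ⋆ ex x
  Bs-equation x = HR.begin
    ex 1# ⋆ Bs x HR.≈⟨ H.*-congʳ (mk λ n → solve 2 (λ a b → a := (a :- b) :+ b) refl _ _) ⟩
    ((ex 1# ⊕ ⊖ H.1#) ⊕ H.1#) ⋆ Bs x HR.≈⟨ H.distribʳ _ _ _ ⟩
    (ex 1# ⊕ ⊖ H.1#) ⋆ Bs x ⊕ H.1# ⋆ Bs x HR.≈⟨ H.+-cong difference (H.*-identityˡ _) ⟩
    var ⋆ ex x ⊕ Bs x HR.≈⟨ H.+-comm _ _ ⟩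
    Bs x ⊕ var ⋆ ex x HR.∎
    where
    divisor : egf expSeries-1 ≋ ex 1# ⊕ ⊖ H.1#
    divisor .at n = trans (solve 3 (λ a b c → a :* (b :- c) := a :* b :- a :* c) refl _ _ _)
      (+-cong (egf-expSeries 1# .at n) (-‿cong (egf-const 1# .at n)))
    shifted : ∀ n → egf (shift (expSeries x)) n ≈ fromℕ n * ex x (n ∸ 1)
    shifted zero    = trans (zeroʳ _) (sym (zeroˡ _))
    shifted (suc n) = trans (*-congʳ (×1-homo-* (suc n) (n !))) (trans (*-assoc _ _ _) (*-congˡ (egf-expSeries x .at n)))
    difference : (ex 1# ⊕ ⊖ H.1#) ⋆ Bs x ≋ var ⋆ ex x
    difference = HR.begin
      (ex 1# ⊕ ⊖ H.1#) ⋆ Bs x HR.≈⟨ ⋆-cong divisor (mk λ n → /-cancelˡ (n!≉0 n) _) ⟨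
      egf expSeries-1 ⋆ egf (λ n → Bₙ n x / fromℕ (n !)) HR.≈⟨ egf-⊛ expSeries-1 _ ⟨
      egf (expSeries-1 ⊛ λ n → Bₙ n x / fromℕ (n !)) HR.≈⟨ mk (λ n → *-congˡ (Bₙ-generating x n)) ⟩
      egf (shift (expSeries x)) HR.≈⟨ mk (λ n → trans (shifted n) (sym (var-⋆ (ex x) n))) ⟩
      var ⋆ ex x HR.∎

  euler : AppellFamily
  euler = record
    { ε             = - 1#
    ; ε²≈1          = solve 0 ((:- con (+ 1)) :* (:- con (+ 1)) := con (+ 1)) refl
    ; k             = two
    ; k-cancellable = const-cancellable (fromℕ≉0 2)
    ; P             = Eₙ
    ; generating    = λ x → HP.+-cancelʳ (ex 1# ⋆ Es x) _ _ (HR.begin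
        Es x ⊕ ex 1# ⋆ Es x                                          HR.≈⟨ sum-eq x ⟩
        two ⋆ ex x                                                   HR.≈⟨ H.+-identityʳ _ ⟨
        two ⋆ ex x ⊕ H.0#                                            HR.≈⟨ H.+-congˡ (cancel x) ⟨
        two ⋆ ex x ⊕ (const (- 1#) ⋆ ex 1# ⋆ Es x ⊕ ex 1# ⋆ Es x)    HR.≈⟨ H.+-assoc _ _ _ ⟨
        two ⋆ ex x ⊕ const (- 1#) ⋆ ex 1# ⋆ Es x ⊕ ex 1# ⋆ Es x      HR.∎)
    }
    where
    sum-eq : ∀ x → Es x ⊕ ex 1# ⋆ Es x ≋ two ⋆ ex x
    sum-eq x = H.trans (solve₁ 2 (λ e u → e :+₁ u :*₁ e :=₁ (u :+₁ con₁ 1) :*₁ e) H.refl (Es x) (ex 1#)) (Es-equation x)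
    cancel : ∀ x → const (- 1#) ⋆ ex 1# ⋆ Es x ⊕ ex 1# ⋆ Es x ≋ H.0#
    cancel x = H.trans (H.+-congʳ (H.trans (H.*-assoc _ _ _) (const-⋆ (- 1#) (ex 1# ⋆ Es x))))
      (mk λ n → solve 1 (λ x → (:- con (+ 1)) :* x :+ x := con (+ 0)) refl _)

  bernoulli : AppellFamily
  bernoulli = record
    { ε             = 1#
    ; ε²≈1          = *-identityˡ 1#
    ; k             = ⊖ var
    ; k-cancellable = λ f g e → var-cancellable f g (HP.-‿injective
        (H.trans (HP.-‿distribˡ-* var f) (H.trans e (H.sym (HP.-‿distribˡ-* var g)))))
    ; P             = Bₙ
    ; generating    = λ x → HR.begin
        Bs x                                        HR.≈⟨ mk (λ n → solve 2 (λ b v → b := :- v :+ (b :+ v)) refl _ _) ⟩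
        ⊖ (var ⋆ ex x) ⊕ (Bs x ⊕ var ⋆ ex x)        HR.≈⟨ H.+-cong (HP.-‿distribˡ-* var (ex x)) (H.sym (Bs-equation x)) ⟩
        (⊖ var) ⋆ ex x ⊕ ex 1# ⋆ Bs x               HR.≈⟨ H.+-congˡ (H.*-congʳ (H.*-identityˡ (ex 1#))) ⟨
        (⊖ var) ⋆ ex x ⊕ const 1# ⋆ ex 1# ⋆ Bs x    HR.∎
    }

  module Eu = AppellFamily euler
  module Be = AppellFamily bernoulli
  module PE = Periodization euler
  module PB = Periodization bernoulli

  1^≈1 : ∀ n → 1# ^ n ≈ 1#
  1^≈1 zero    = refl
  1^≈1 (suc n) = trans (*-identityˡ _) (1^≈1 n)

  1^ℤ≈1 : ∀ i → 1# ^ℤ i ≈ 1#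
  1^ℤ≈1 (+ n)    = 1^≈1 n
  1^ℤ≈1 -[1+ n ] = trans (^-congˡ (suc n) (trans (sym (*-identityˡ _)) (⁻¹-inverseʳ 1≉0))) (1^≈1 (suc n))

  𝓑≈𝓟 : ∀ n x → 𝓑 n x ≈ PB.𝓟 n x
  𝓑≈𝓟 n x = sym (trans (*-congʳ (1^ℤ≈1 ⌊ x ⌋)) (*-identityˡ _))

  𝓑-cong : ∀ n {x y} → x ≈ y → 𝓑 n x ≈ 𝓑 n y
  𝓑-cong n e = trans (𝓑≈𝓟 n _) (trans (PB.𝓟-cong n e) (sym (𝓑≈𝓟 n _)))

  𝓑-shift : ∀ n x m → 𝓑 n (x + fromℤ m) ≈ 𝓑 n x
  𝓑-shift n x m = trans (𝓑≈𝓟 n _) (trans (PB.𝓟-shift n x m)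
    (trans (*-congʳ (1^ℤ≈1 m)) (trans (*-identityˡ _) (sym (𝓑≈𝓟 n x)))))

  𝓔-multiplication : ∀ a .{{_ : NonZero a}} → (- 1#) ^ a ≈ - 1# → ∀ n u →
    𝓔 n u ≈ fromℕ a ^ n * ∑< a λ l → (- 1#) ^ l * 𝓔 n ((u + fromℕ l) / fromℕ a)
  𝓔-multiplication a odd n u = trans (sym (*-identityˡ _))
    (PE.𝓟-multiplication a odd n 1# (H.trans (dilate-const _ _) (H.sym (H.*-identityˡ two))) u)

  𝓑-multiplication : ∀ b .{{_ : NonZero b}} n u →
    fromℕ b * 𝓑 n u ≈ fromℕ b ^ n * ∑< b λ l → 𝓑 n ((u + fromℕ l) / fromℕ b)
  𝓑-multiplication b n u = begin
    fromℕ b * 𝓑 n u        ≈⟨ *-congˡ (𝓑≈𝓟 n u) ⟩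
    fromℕ b * PB.𝓟 n u     ≈⟨ PB.𝓟-multiplication b (1^≈1 b) n (fromℕ b) dilate-k u ⟩
    fromℕ b ^ n * ∑< b (λ l → 1# ^ l * PB.𝓟 n ((u + fromℕ l) / fromℕ b))
      ≈⟨ *-congˡ (∑<-cong′ b λ l → trans (*-congʳ (1^≈1 l)) (trans (*-identityˡ _) (sym (𝓑≈𝓟 n _)))) ⟩
    fromℕ b ^ n * ∑< b (λ l → 𝓑 n ((u + fromℕ l) / fromℕ b)) ∎
    where
    dilate-k : dilate (fromℕ b) (⊖ var) ≋ const (fromℕ b) ⋆ ⊖ var
    dilate-k = HR.begin
      dilate (fromℕ b) (⊖ var)    HR.≈⟨ mk (λ n → sym (-‿distribʳ-* _ _)) ⟩
      ⊖ dilate (fromℕ b) var      HR.≈⟨ H.-‿cong (dilate-var (fromℕ b)) ⟩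
      ⊖ (const (fromℕ b) ⋆ var)   HR.≈⟨ HP.-‿distribʳ-* _ var ⟩
      const (fromℕ b) ⋆ ⊖ var     HR.∎

  e b V : Ser
  e = Es 0#
  b = Bs 0#
  V = ex 1#

  e-equation : e ⊕ V ⋆ e ≋ two
  e-equation = H.trans (solve₁ 2 (λ e u → e :+₁ u :*₁ e :=₁ (u :+₁ con₁ 1) :*₁ e) H.refl e V)
    (H.trans (Es-equation 0#) (H.trans (H.*-congˡ ex-0) (H.*-identityʳ two)))

  b-equation : V ⋆ b ≋ b ⊕ var
  b-equation = H.trans (Bs-equation 0#) (H.+-congˡ (H.trans (H.*-congˡ ex-0) (H.*-identityʳ var)))

  reflect : Ser → Ser
  reflect = dilate (- 1#)

  ex[-1]⋆V : ex (- 1#) ⋆ V ≋ H.1#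
  ex[-1]⋆V = H.trans (ex-+ (- 1#) 1#) (H.trans (ex-cong (-‿inverseˡ 1#)) ex-0)

  -- Replacing t by -t in V b = b + t gives e^(-t) b(-t) = b(-t) - t; multiplication by V = eᵗ
  -- clears the inverse exponential.
  reflect-b-equation : V ⋆ reflect b ≋ reflect b ⊕ V ⋆ var
  reflect-b-equation = HR.begin
    V ⋆ b⁻
      HR.≈⟨ H.*-congˡ (mk λ n → solve 2 (λ b v → b := (b :+ (:- con (+ 1)) :* v) :+ v) refl _ _) ⟩
    V ⋆ ((b⁻ ⊕ (- 1#) • var) ⊕ var)
      HR.≈⟨ H.*-congˡ (H.+-congʳ (H.+-congˡ (H.sym (H.trans (dilate-var (- 1#)) (const-⋆ (- 1#) var))))) ⟩
    V ⋆ ((b⁻ ⊕ reflect var) ⊕ var)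
      HR.≈⟨ H.*-congˡ (H.+-congʳ (H.trans (H.sym (dilate-⊕ (- 1#) b var)) (H.trans (H.sym (dilate-cong (- 1#) b-equation)) (dilate-⋆ (- 1#) V b)))) ⟩
    V ⋆ (reflect V ⋆ b⁻ ⊕ var)
      HR.≈⟨ H.*-congˡ (H.+-congʳ (H.*-congʳ (H.trans (dilate-ex (- 1#) 1#) (ex-cong (*-identityʳ _))))) ⟩
    V ⋆ (ex (- 1#) ⋆ b⁻ ⊕ var)
      HR.≈⟨ solve₁ 4 (λ V W b v → V :*₁ (W :*₁ b :+₁ v) :=₁ (W :*₁ V) :*₁ b :+₁ V :*₁ v) H.refl V (ex (- 1#)) b⁻ var ⟩
    (ex (- 1#) ⋆ V) ⋆ b⁻ ⊕ V ⋆ var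
      HR.≈⟨ H.+-congʳ (H.trans (H.*-congʳ ex[-1]⋆V) (H.*-identityˡ b⁻)) ⟩
    b⁻ ⊕ V ⋆ var HR.∎
    where b⁻ = reflect b

  -- Expanding V ⋆ b ⋆ b(-t) by the equation of either factor leaves t ⋆ b(-t) = t ⋆ V ⋆ b, and t
  -- cancels.
  reflect-b : reflect b ≋ V ⋆ b
  reflect-b = var-cancellable _ _ (HP.+-cancelˡ (b ⋆ b⁻) _ _ (HR.begin
    b ⋆ b⁻ ⊕ var ⋆ b⁻      HR.≈⟨ H.distribʳ b⁻ b var ⟨
    (b ⊕ var) ⋆ b⁻         HR.≈⟨ H.*-congʳ b-equation ⟨
    (V ⋆ b) ⋆ b⁻           HR.≈⟨ solve₁ 3 (λ V b c → (V :*₁ b) :*₁ c :=₁ b :*₁ (V :*₁ c)) H.refl V b b⁻ ⟩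
    b ⋆ (V ⋆ b⁻)           HR.≈⟨ H.*-congˡ reflect-b-equation ⟩
    b ⋆ (b⁻ ⊕ V ⋆ var)     HR.≈⟨ solve₁ 4 (λ V b c v → b :*₁ (c :+₁ V :*₁ v) :=₁ b :*₁ c :+₁ v :*₁ (V :*₁ b)) H.refl V b b⁻ var ⟩
    b ⋆ b⁻ ⊕ var ⋆ (V ⋆ b) HR.∎))
    where b⁻ = reflect b

  -- The generating function form of (-1)ⁿ Bₙ(r) = Bₙ(1 - r).
  reflect-Bs : ∀ r → reflect (Bs r) ≋ ex (1# - r) ⋆ b
  reflect-Bs r = HR.begin
    reflect (Bs r)                HR.≈⟨ dilate-cong (- 1#) (Be.gf≋ r) ⟩
    reflect (ex r ⋆ b)            HR.≈⟨ dilate-⋆ (- 1#) (ex r) b ⟩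
    reflect (ex r) ⋆ reflect b    HR.≈⟨ H.*-cong (dilate-ex (- 1#) r) reflect-b ⟩
    ex (- 1# * r) ⋆ (V ⋆ b)       HR.≈⟨ H.*-assoc _ V b ⟨
    (ex (- 1# * r) ⋆ V) ⋆ b       HR.≈⟨ H.*-congʳ (ex-+ _ _) ⟩
    ex (- 1# * r + 1#) ⋆ b        HR.≈⟨ H.*-congʳ (ex-cong (solve 1 (λ r → (:- con (+ 1)) :* r :+ con (+ 1) := con (+ 1) :- r) refl r)) ⟩
    ex (1# - r) ⋆ b               HR.∎

-- The identity for a product of an Euler and a Bernoulli function.

module ProductIdentities {c₀ ℓ₁ ℓ₂} (ℝ : RealField c₀ ℓ₁ ℓ₂) where
  open Dedekind ℝ
  open RealArith ℝ
  open FiniteSums ℝ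
  open HurwitzReal ℝ
  open Exponentials ℝ
  open Periodic ℝ
  open EulerBernoulli ℝ
  open Hurwitz commutativeRing hiding (commutativeRing)
  open Solver using (_:+_; _:*_; _:-_; :-_; _:=_; solve; con)
  open IsDecTotalOrder isDecTotalOrder
    using (total; ≤-respˡ-≈; ≤-respʳ-≈; _≤?_)
    renaming (trans to ≤-trans)
  open SemiringExp semiring using (^-homo-*)
  open Bivariate commutativeRing using (module H₂; inU; inV; inU+V; inU-cong; inU-+; inU-*; inU+V-cong; inU+V-*; ⋆-inU; ⋆-inV)
  module K = CommutativeRing H₂.commutativeRing
  open SemiringSolver K.commutativeSemiring using ()
    renaming (solve to solve₂; _:+_ to _:+₂_; _:*_ to _:*₂_; _:=_ to _:=₂_)
  open PartialFractions H₂.commutativeRing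
  open SetoidReasoning setoid
  private
    module KR = SetoidReasoning K.setoid

    two₂ U₂ V₂ e₁ e₁₂ b₂ v₂ : K.Carrier
    two₂ = inV two
    U₂   = inU V
    V₂   = inV V
    e₁   = inU e
    e₁₂  = inU+V e
    b₂   = inV b
    v₂   = inV var

    inU-const : ∀ x → inU (const x) K.≈ inV (const x)
    inU-const x .H₂.at zero    .at n       = refl
    inU-const x .H₂.at (suc m) .at zero    = refl
    inU-const x .H₂.at (suc m) .at (suc n) = refl

    inU+V-const : ∀ x → inU+V (const x) K.≈ inV (const x)
    inU+V-const x .H₂.at zero    .at n = refl
    inU+V-const x .H₂.at (suc m) .at n = refl

    inV-* : ∀ f g → inV (f ⋆ g) K.≈ inV f K.* inV g
    inV-* = H₂.const-*

    inU+V-ex : ∀ x → inU+V (ex x) K.≈ inU (ex x) K.* inV (ex x)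
    inU+V-ex x .H₂.at m .at n = begin
      x ^ (m ℕ.+ n)                    ≈⟨ ^-homo-* x m n ⟩
      x ^ m * x ^ n                    ≈⟨ const-⋆ (x ^ m) (ex x) .at n ⟨
      (const (x ^ m) ⋆ ex x) n         ≈⟨ ⋆-inV (inU (ex x)) (ex x) m n ⟨
      (inU (ex x) K.* inV (ex x)) m n  ∎

    e₁-equation : e₁ K.+ U₂ K.* e₁ K.≈ two₂
    e₁-equation = K.trans (K.+-congˡ (K.sym (inU-* V e))) (K.trans (K.sym (inU-+ e (V ⋆ e)))
      (K.trans (inU-cong e-equation) (inU-const _)))

    e₁₂-equation : e₁₂ K.+ U₂ K.* V₂ K.* e₁₂ K.≈ two₂
    e₁₂-equation = K.trans (K.+-congˡ (K.trans (K.*-congʳ (K.sym (inU+V-ex 1#))) (K.sym (inU+V-* V e))))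
      (K.trans (inU+V-cong e-equation) (inU+V-const _))

    b₂-equation : V₂ K.* b₂ K.≈ b₂ K.+ v₂
    b₂-equation = K.trans (K.sym (inV-* V b)) (K.trans (H₂.const-cong b-equation) (H₂.const-+ b var))

    Es-U : ∀ x → inU (Es x) K.≈ inU (ex x) K.* e₁
    Es-U x = K.trans (inU-cong (Eu.gf≋ x)) (inU-* (ex x) e)

    Es-U+V : ∀ x → inU+V (Es x) K.≈ inU (ex x) K.* inV (ex x) K.* e₁₂
    Es-U+V x = K.trans (inU+V-cong (Eu.gf≋ x)) (K.trans (inU+V-* (ex x) e) (K.*-congʳ (inU+V-ex x)))

    Bs-V : ∀ x → inV (Bs x) K.≈ inV (ex x) K.* b₂
    Bs-V x = K.trans (H₂.const-cong (Be.gf≋ x)) (inV-* (ex x) b)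

    reflect-Bs-V : ∀ x → inV (reflect (Bs x)) K.≈ inV (ex (1# - x)) K.* b₂
    reflect-Bs-V x = K.trans (H₂.const-cong (reflect-Bs x)) (inV-* _ b)

    inU-ex-+ : ∀ {x y z w} → x + y ≈ z + w → inU (ex x) K.* inU (ex y) K.≈ inU (ex z) K.* inU (ex w)
    inU-ex-+ {x} {y} {z} {w} q = K.trans (K.sym (inU-* _ _)) (K.trans
      (inU-cong (H.trans (ex-+ x y) (H.trans (ex-cong q) (H.sym (ex-+ z w))))) (inU-* _ _))

    inV-ex-+ : ∀ {x y z w} → x + y ≈ z + w → inV (ex x) K.* inV (ex y) K.≈ inV (ex z) K.* inV (ex w)
    inV-ex-+ {x} {y} {z} {w} q = K.trans (K.sym (inV-* _ _)) (K.trans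
      (H₂.const-cong (H.trans (ex-+ x y) (H.trans (ex-cong q) (H.sym (ex-+ z w))))) (inV-* _ _))

    inU-ex-0 : inU (ex 0#) K.≈ K.1#
    inU-ex-0 = K.trans (inU-cong ex-0) (inU-const 1#)

    inV-ex-0 : inV (ex 0#) K.≈ K.1#
    inV-ex-0 = H₂.const-cong ex-0

    -- Writing E(x;u) and B(x;v) for the generating functions, these are 2 E(s;u) B(t;v), v E(t;u+v)
    -- E(r;u) and 2 E(s;u+v) B(r;-v).
    left cross right : Carrier → Carrier → K.Carrier
    left s t = two₂ K.* (inU (Es s) K.* inV (Bs t))
    cross r t = v₂ K.* (inU+V (Es t) K.* inU (Es r))
    right r s = two₂ K.* (inU+V (Es s) K.* inV (reflect (Bs r)))

    -- `partialFractions₀` times e^(su) e^(tv), where s = r + t. The V on its right side completes t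
    -- to t + 1 = s + (1 - r), so that e^(sv) joins the Euler series in u + v and e^((1-r)v) is what
    -- reflection asks for.
    series₀ : ∀ r t → left (r + t) t K.+ cross r t K.≈ right r (r + t)
    series₀ r t = KR.begin
      left s t K.+ cross r t
        KR.≈⟨ K.+-cong (K.*-congˡ (K.*-cong (Es-U s) (Bs-V t))) (K.*-congˡ (K.*-cong (Es-U+V t) (Es-U r))) ⟩
      two₂ K.* ((Su K.* e₁) K.* (Tv K.* b₂)) K.+ v₂ K.* ((Tu K.* Tv K.* e₁₂) K.* (Ru K.* e₁))
        KR.≈⟨ solve₂ 9 (λ two S e b T v Tu Ru e′ → two :*₂ ((S :*₂ e) :*₂ (T :*₂ b)) :+₂ v :*₂ ((Tu :*₂ T :*₂ e′) :*₂ (Ru :*₂ e))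
              :=₂ S :*₂ T :*₂ (two :*₂ (e :*₂ b)) :+₂ (Ru :*₂ Tu) :*₂ T :*₂ (v :*₂ (e′ :*₂ e))) K.refl
              two₂ Su e₁ b₂ Tv v₂ Tu Ru e₁₂ ⟩
      Su K.* Tv K.* (two₂ K.* (e₁ K.* b₂)) K.+ (Ru K.* Tu) K.* Tv K.* (v₂ K.* (e₁₂ K.* e₁))
        KR.≈⟨ K.+-congˡ (K.*-congʳ (K.*-congʳ Ru*Tu)) ⟩
      Su K.* Tv K.* (two₂ K.* (e₁ K.* b₂)) K.+ Su K.* Tv K.* (v₂ K.* (e₁₂ K.* e₁))
        KR.≈⟨ K.distribˡ (Su K.* Tv) _ _ ⟨
      Su K.* Tv K.* (two₂ K.* (e₁ K.* b₂) K.+ v₂ K.* (e₁₂ K.* e₁))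
        KR.≈⟨ K.*-congˡ (partialFractions₀ e₁-equation e₁₂-equation b₂-equation) ⟩
      Su K.* Tv K.* (two₂ K.* (e₁₂ K.* (V₂ K.* b₂)))
        KR.≈⟨ solve₂ 6 (λ S T two e V b → S :*₂ T :*₂ (two :*₂ (e :*₂ (V :*₂ b))) :=₂ two :*₂ ((S :*₂ e) :*₂ ((T :*₂ V) :*₂ b))) K.refl
              Su Tv two₂ e₁₂ V₂ b₂ ⟩
      two₂ K.* ((Su K.* e₁₂) K.* ((Tv K.* V₂) K.* b₂))
        KR.≈⟨ K.*-congˡ (K.*-congˡ (K.*-congʳ (inV-ex-+ (solve 2 (λ r t → t :+ con (+ 1) := r :+ t :+ (con (+ 1) :- r)) refl r t)))) ⟩
      two₂ K.* ((Su K.* e₁₂) K.* ((Sv K.* Qv) K.* b₂))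
        KR.≈⟨ solve₂ 6 (λ S e T Q b two → two :*₂ ((S :*₂ e) :*₂ ((T :*₂ Q) :*₂ b)) :=₂ two :*₂ ((S :*₂ T :*₂ e) :*₂ (Q :*₂ b))) K.refl
              Su e₁₂ Sv Qv b₂ two₂ ⟩
      two₂ K.* ((Su K.* Sv K.* e₁₂) K.* (Qv K.* b₂))
        KR.≈⟨ K.*-congˡ (K.*-cong (Es-U+V s) (reflect-Bs-V r)) ⟨
      right r s KR.∎
      where
      s  = r + t
      Su = inU (ex s)
      Tu = inU (ex t)
      Ru = inU (ex r)
      Tv = inV (ex t)
      Sv = inV (ex s)
      Qv = inV (ex (1# - r))
      Ru*Tu : Ru K.* Tu K.≈ Su
      Ru*Tu = K.trans (inU-ex-+ (sym (+-identityʳ s))) (K.trans (K.*-congˡ inU-ex-0) (K.*-identityʳ Su))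

    -- `partialFractions₁` times e^(su) e^(tv), now with s = r + t - 1. Here t = s + (1 - r) needs
    -- no V, while the U in the cross term restores s + 1 = r + t.
    series₁ : ∀ r t → left (r + t - 1#) t K.≈ cross r t K.+ right r (r + t - 1#)
    series₁ r t = KR.begin
      left s t
        KR.≈⟨ K.*-congˡ (K.*-cong (Es-U s) (Bs-V t)) ⟩
      two₂ K.* ((Su K.* e₁) K.* (Tv K.* b₂))
        KR.≈⟨ solve₂ 5 (λ two S e b T → two :*₂ ((S :*₂ e) :*₂ (T :*₂ b)) :=₂ S :*₂ T :*₂ (two :*₂ (e :*₂ b))) K.refl
              two₂ Su e₁ b₂ Tv ⟩
      Su K.* Tv K.* (two₂ K.* (e₁ K.* b₂))
        KR.≈⟨ K.*-congˡ (partialFractions₁ e₁-equation e₁₂-equation b₂-equation) ⟩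
      Su K.* Tv K.* (v₂ K.* (U₂ K.* (e₁₂ K.* e₁)) K.+ two₂ K.* (e₁₂ K.* b₂))
        KR.≈⟨ solve₂ 8 (λ S T v U f e two b → S :*₂ T :*₂ (v :*₂ (U :*₂ (f :*₂ e)) :+₂ two :*₂ (f :*₂ b))
              :=₂ (S :*₂ U) :*₂ T :*₂ (v :*₂ (f :*₂ e)) :+₂ T :*₂ (two :*₂ (S :*₂ f :*₂ b))) K.refl
              Su Tv v₂ U₂ e₁₂ e₁ two₂ b₂ ⟩
      (Su K.* U₂) K.* Tv K.* (v₂ K.* (e₁₂ K.* e₁)) K.+ Tv K.* (two₂ K.* (Su K.* e₁₂ K.* b₂))
        KR.≈⟨ K.+-cong (K.*-congʳ (K.*-congʳ (inU-ex-+ (solve 2 (λ r t → r :+ t := r :+ t :- con (+ 1) :+ con (+ 1)) refl r t)))) (K.*-congʳ Sv*Qv) ⟨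
      (Ru K.* Tu) K.* Tv K.* (v₂ K.* (e₁₂ K.* e₁)) K.+ (Sv K.* Qv) K.* (two₂ K.* (Su K.* e₁₂ K.* b₂))
        KR.≈⟨ solve₂ 11 (λ R T′ T v f e S′ Q two S b → (R :*₂ T′) :*₂ T :*₂ (v :*₂ (f :*₂ e)) :+₂ (S′ :*₂ Q) :*₂ (two :*₂ (S :*₂ f :*₂ b))
              :=₂ v :*₂ ((T′ :*₂ T :*₂ f) :*₂ (R :*₂ e)) :+₂ two :*₂ ((S :*₂ S′ :*₂ f) :*₂ (Q :*₂ b))) K.refl
              Ru Tu Tv v₂ e₁₂ e₁ Sv Qv two₂ Su b₂ ⟩
      v₂ K.* ((Tu K.* Tv K.* e₁₂) K.* (Ru K.* e₁)) K.+ two₂ K.* ((Su K.* Sv K.* e₁₂) K.* (Qv K.* b₂))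
        KR.≈⟨ K.+-cong (K.*-congˡ (K.*-cong (Es-U+V t) (Es-U r))) (K.*-congˡ (K.*-cong (Es-U+V s) (reflect-Bs-V r))) ⟨
      cross r t K.+ right r s KR.∎
      where
      s  = r + t - 1#
      Su = inU (ex s)
      Tu = inU (ex t)
      Ru = inU (ex r)
      Tv = inV (ex t)
      Sv = inV (ex s)
      Qv = inV (ex (1# - r))
      Sv*Qv : Sv K.* Qv K.≈ Tv
      Sv*Qv = K.trans (inV-ex-+ (solve 2 (λ r t → r :+ t :- con (+ 1) :+ (con (+ 1) :- r) := t :+ con (+ 0)) refl r t))
        (K.trans (K.*-congˡ inV-ex-0) (K.*-identityʳ Tv))

  -- n · convU m n f g and convV m n f g are the coefficients of uᵐvⁿ/m!n! in
  -- v f(u) g(u+v) and in f(-v) g(u+v).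
  convU convV : ℕ → ℕ → Ser → Ser → Carrier
  convU m n f g = ∑< (suc m) λ j → fromℕ (m C j) * (f j * g (m ∸ j ℕ.+ (n ∸ 1)))
  convV m n f g = ∑< (suc n) λ h → fromℕ (n C h) * ((- 1#) ^ h * f h * g (m ℕ.+ (n ∸ h)))

  private
    two-⋆ : ∀ F m n → (two₂ K.* F) m n ≈ fromℕ 2 * F m n
    two-⋆ F m n = trans (H₂.const-⋆ two F .H₂.at m .at n) (const-⋆ (fromℕ 2) (F m) .at n)

    left-coeff : ∀ s t m n → left s t m n ≈ fromℕ 2 * (Eₙ m s * Bₙ n t)
    left-coeff s t m n = trans (two-⋆ (inU (Es s) K.* inV (Bs t)) m n)
      (*-congˡ (trans (⋆-inV (inU (Es s)) (Bs t) m n) (const-⋆ (Eₙ m s) (Bs t) .at n)))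

    cross-coeff : ∀ r t m n → cross r t m n ≈ fromℕ n * convU m n (Es r) (Es t)
    cross-coeff r t m n = begin
      (v₂ K.* F) m n            ≈⟨ H₂.const-⋆ var F .H₂.at m .at n ⟩
      (var ⋆ F m) n             ≈⟨ var-⋆ (F m) n ⟩
      fromℕ n * F m (n ∸ 1)     ≈⟨ *-congˡ (trans (⋆-inU (inU+V (Es t)) (Es r) m (n ∸ 1)) (trans (⋆-comm _ (Es r) .at m) (⋆-binomial (Es r) _ m))) ⟩
      fromℕ n * convU m n (Es r) (Es t) ∎
      where F = inU+V (Es t) K.* inU (Es r)

    right-coeff : ∀ r s m n → right r s m n ≈ fromℕ 2 * convV m n (Bs r) (Es s)
    right-coeff r s m n = trans (two-⋆ (inU+V (Es s) K.* inV (reflect (Bs r))) m n)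
      (*-congˡ (trans (⋆-inV (inU+V (Es s)) (reflect (Bs r)) m n)
        (trans (⋆-comm _ (reflect (Bs r)) .at n) (⋆-binomial (reflect (Bs r)) _ n))))

  -- Comparison of coefficients of uᵐvⁿ, valid for all r and t. Their ranges matter only when
  -- polynomials are replaced by `𝓔` and `𝓑`.
  polynomialIdentity₀ : ∀ m n r t →
    fromℕ 2 * (Eₙ m (r + t) * Bₙ n t) + fromℕ n * convU m n (Es r) (Es t) ≈ fromℕ 2 * convV m n (Bs r) (Es (r + t))
  polynomialIdentity₀ m n r t = trans (sym (+-cong (left-coeff (r + t) t m n) (cross-coeff r t m n)))
    (trans (series₀ r t .H₂.at m .at n) (right-coeff r (r + t) m n))

  polynomialIdentity₁ : ∀ m n r t → let s = r + t - 1# in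
    fromℕ 2 * (Eₙ m s * Bₙ n t) ≈ fromℕ n * convU m n (Es r) (Es t) + fromℕ 2 * convV m n (Bs r) (Es s)
  polynomialIdentity₁ m n r t = trans (sym (left-coeff s t m n)) (trans (series₁ r t .H₂.at m .at n)
    (+-cong (cross-coeff r t m n) (right-coeff r s m n)))
    where s = r + t - 1#

  convU-scale : ∀ m n σ τ {f f′ g g′ : Ser} → (∀ j → f j ≈ σ * f′ j) → (∀ j → g j ≈ τ * g′ j) →
    convU m n f g ≈ σ * τ * convU m n f′ g′
  convU-scale m n σ τ p q = trans
    (∑<-cong′ (suc m) λ j → trans (*-congˡ (*-cong (p j) (q _)))
      (solve 5 (λ c s t f g → c :* ((s :* f) :* (t :* g)) := s :* t :* (c :* (f :* g))) refl _ _ _ _ _))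
    (sym (∑<-*ˡ (suc m) _ _))

  convV-scale : ∀ m n τ {f f′ g g′ : Ser} → (∀ j → f j ≈ f′ j) → (∀ j → g j ≈ τ * g′ j) →
    convV m n f g ≈ τ * convV m n f′ g′
  convV-scale m n τ p q = trans
    (∑<-cong′ (suc n) λ j → trans (*-congˡ (*-cong (*-congˡ (p j)) (q _)))
      (solve 5 (λ c s t f g → c :* ((s :* f) :* (t :* g)) := t :* (c :* (s :* f :* g))) refl _ _ _ _ _))
    (sym (∑<-*ˡ (suc n) _ _))

  -- The integer parts of r and t contribute the same sign σ τ to all three products, so only the
  -- fractional parts remain; whether these add up to at least 1 decides which polynomial identity
  -- is used.
  𝓔𝓑-product : ∀ m n r t →
    fromℕ 2 * (𝓔 m (r + t) * 𝓑 n t) + fromℕ n * convU m n (λ j → 𝓔 j r) (λ j → 𝓔 j t)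
      ≈ fromℕ 2 * convV m n (λ j → 𝓑 j r) (λ j → 𝓔 j (r + t))
  𝓔𝓑-product m n r t = by-floor
    where
    r₀ t₀ s₀ σ τ : Carrier
    r₀ = frac r
    t₀ = frac t
    s₀ = r₀ + t₀
    σ  = (- 1#) ^ℤ ⌊ r ⌋
    τ  = (- 1#) ^ℤ ⌊ t ⌋

    𝓔-sum : ∀ j → 𝓔 j (r + t) ≈ σ * τ * 𝓔 j s₀
    𝓔-sum j = begin
      𝓔 j (r + t) ≈⟨ PE.𝓟-cong j split ⟩
      𝓔 j (s₀ + fromℤ (⌊ r ⌋ ℤ.+ ⌊ t ⌋)) ≈⟨ 𝓔-shift j s₀ (⌊ r ⌋ ℤ.+ ⌊ t ⌋) ⟩
      (- 1#) ^ℤ (⌊ r ⌋ ℤ.+ ⌊ t ⌋) * 𝓔 j s₀ ≈⟨ *-congʳ (^ℤ-homo-* -1≉0 ⌊ r ⌋ ⌊ t ⌋) ⟩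
      σ * τ * 𝓔 j s₀ ∎
      where
      split : r + t ≈ s₀ + fromℤ (⌊ r ⌋ ℤ.+ ⌊ t ⌋)
      split = trans (solve 4 (λ r t k l → r :+ t := (r :- k) :+ (t :- l) :+ (k :+ l)) refl r t _ _)
        (+-congˡ (sym (fromℤ-homo-+ ⌊ r ⌋ ⌊ t ⌋)))

    -- Common frame of the two cases: δ is the sign of the carry, with s = s₀, δ = 1 when there is
    -- none and s = s₀ - 1, δ = -1 otherwise.
    scaled : ∀ δ s → (∀ j → 𝓔 j s₀ ≈ δ * Eₙ j s) →
      fromℕ 2 * (δ * Eₙ m s * Bₙ n t₀) + fromℕ n * convU m n (Es r₀) (Es t₀) ≈ fromℕ 2 * (δ * convV m n (Bs r₀) (Es s)) →
      fromℕ 2 * (𝓔 m (r + t) * 𝓑 n t) + fromℕ n * convU m n (λ j → 𝓔 j r) (λ j → 𝓔 j t)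
        ≈ fromℕ 2 * convV m n (λ j → 𝓑 j r) (λ j → 𝓔 j (r + t))
    scaled δ s unit h = begin
      fromℕ 2 * (𝓔 m (r + t) * 𝓑 n t) + fromℕ n * convU m n (λ j → 𝓔 j r) (λ j → 𝓔 j t)
        ≈⟨ +-cong (*-congˡ (*-congʳ (E-s m))) (*-congˡ (convU-scale m n σ τ {f′ = Es r₀} {g′ = Es t₀} (λ _ → refl) (λ _ → refl))) ⟩
      fromℕ 2 * (σ * τ * δ * Eₙ m s * Bₙ n t₀) + fromℕ n * (σ * τ * convU m n (Es r₀) (Es t₀))
        ≈⟨ solve 7 (λ two st d E B q u → two :* (st :* d :* E :* B) :+ q :* (st :* u) := st :* (two :* (d :* E :* B) :+ q :* u)) refl
             (fromℕ 2) (σ * τ) δ (Eₙ m s) (Bₙ n t₀) (fromℕ n) _ ⟩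
      σ * τ * (fromℕ 2 * (δ * Eₙ m s * Bₙ n t₀) + fromℕ n * convU m n (Es r₀) (Es t₀)) ≈⟨ *-congˡ h ⟩
      σ * τ * (fromℕ 2 * (δ * convV m n (Bs r₀) (Es s)))
        ≈⟨ solve 4 (λ st two d v → st :* (two :* (d :* v)) := two :* (st :* d :* v)) refl (σ * τ) (fromℕ 2) δ _ ⟩
      fromℕ 2 * (σ * τ * δ * convV m n (Bs r₀) (Es s))
        ≈⟨ *-congˡ (convV-scale m n (σ * τ * δ) (λ _ → refl) E-s) ⟨
      fromℕ 2 * convV m n (λ j → 𝓑 j r) (λ j → 𝓔 j (r + t)) ∎
      where
      E-s : ∀ j → 𝓔 j (r + t) ≈ σ * τ * δ * Eₙ j s
      E-s j = trans (𝓔-sum j) (trans (*-congˡ (unit j)) (sym (*-assoc _ _ _)))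

    0≤s₀ : 0# ≤ s₀
    0≤s₀ = ≤-trans (≤-respʳ-≈ (sym (+-identityʳ r₀)) (0≤frac r)) (+-monoʳ-≤ r₀ (0≤frac t))

    by-floor : fromℕ 2 * (𝓔 m (r + t) * 𝓑 n t) + fromℕ n * convU m n (λ j → 𝓔 j r) (λ j → 𝓔 j t)
        ≈ fromℕ 2 * convV m n (λ j → 𝓑 j r) (λ j → 𝓔 j (r + t))
    by-floor with 1# ≤? s₀
    ... | no 1≰s₀ = scaled 1# s₀ (λ j → trans (𝓔-unit j 0≤s₀ 1≰s₀) (sym (*-identityˡ _)))
      (trans (+-congʳ (*-congˡ (*-congʳ (*-identityˡ _))))
        (trans (polynomialIdentity₀ m n r₀ t₀) (*-congˡ (sym (*-identityˡ _)))))
    ... | yes 1≤s₀ = scaled (- 1#) (s₀ - 1#) unit (begin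
      fromℕ 2 * (- 1# * Eₙ m (s₀ - 1#) * Bₙ n t₀) + fromℕ n * convU m n (Es r₀) (Es t₀)
        ≈⟨ solve 4 (λ two E B u → two :* ((:- con (+ 1)) :* E :* B) :+ u := :- (two :* (E :* B)) :+ u) refl _ _ _ _ ⟩
      - (fromℕ 2 * (Eₙ m (s₀ - 1#) * Bₙ n t₀)) + fromℕ n * convU m n (Es r₀) (Es t₀)
        ≈⟨ +-congʳ (-‿cong (polynomialIdentity₁ m n r₀ t₀)) ⟩
      - (fromℕ n * convU m n (Es r₀) (Es t₀) + fromℕ 2 * convV m n (Bs r₀) (Es (s₀ - 1#))) + fromℕ n * convU m n (Es r₀) (Es t₀)
        ≈⟨ solve 3 (λ u two v → :- (u :+ two :* v) :+ u := two :* ((:- con (+ 1)) :* v)) refl _ _ _ ⟩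
      fromℕ 2 * (- 1# * convV m n (Bs r₀) (Es (s₀ - 1#))) ∎)
      where
      t₀≤1 : t₀ ≤ 1#
      t₀≤1 with total t₀ 1#
      ... | inj₁ p = p
      ... | inj₂ p = ⊥-elim (frac≱1 t p)
      1≰s₀-1 : ¬ (1# ≤ s₀ - 1#)
      1≰s₀-1 p = frac≱1 r (≤-trans p (≤-respʳ-≈ (x+y-y≈x r₀ 1#) (+-monoˡ-≤ (- 1#) (+-monoʳ-≤ r₀ t₀≤1))))
      unit : ∀ j → 𝓔 j s₀ ≈ - 1# * Eₙ j (s₀ - 1#)
      unit j = begin
        𝓔 j s₀                             ≈⟨ PE.𝓟-cong j (trans (sym (x-y+y≈x s₀ 1#)) (+-congˡ (sym (+-identityʳ 1#)))) ⟩
        𝓔 j (s₀ - 1# + fromℤ (+ 1))        ≈⟨ 𝓔-shift j (s₀ - 1#) (+ 1) ⟩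
        - 1# * 1# * 𝓔 j (s₀ - 1#)          ≈⟨ *-cong (*-identityʳ _) (𝓔-unit j (x≤y⇒0≤y-x 1≤s₀) 1≰s₀-1) ⟩
        - 1# * Eₙ j (s₀ - 1#)              ∎

-- Arithmetic of the exponents of a, b and c.

module Exponents where
  open ℤSolver.+-*-Solver

  1-[1+j]+j≡0 : ∀ j → + 1 ℤ.- + suc j ℤ.+ + j ≡ 0ℤ
  1-[1+j]+j≡0 j = solve 1 (λ j → con (+ 1) :- (con (+ 1) :+ j) :+ j := con 0ℤ) ≡.refl (+ j)

  1-j+j≡1 : ∀ j → + 1 ℤ.- + j ℤ.+ + j ≡ + 1
  1-j+j≡1 j = solve 1 (λ j → con (+ 1) :- j :+ j := con (+ 1)) ≡.refl (+ j)

  -- Here p and q are one less than in the theorem, and k is the index of the Euler function whose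
  -- multiplication formula produces c^k.
  1+h-p-q+k≡0 : ∀ p q h k → h ℕ.+ k ≡ suc (p ℕ.+ q) → + 1 ℤ.+ + h ℤ.- + suc p ℤ.- + suc q ℤ.+ + k ≡ 0ℤ
  1+h-p-q+k≡0 p q h k e = ≡.trans
    (solve 4 (λ h k p q → con (+ 1) :+ h :- (con (+ 1) :+ p) :- (con (+ 1) :+ q) :+ k
      := (h :+ k) :- (con (+ 1) :+ (p :+ q))) ≡.refl (+ h) (+ k) (+ p) (+ q))
    (≡.trans (≡.cong (λ i → + i ℤ.- + suc (p ℕ.+ q)) e) (ℤ.+-inverseʳ (+ suc (p ℕ.+ q))))

-- Dedekind sums as triple sums, and the reciprocity law.

module Reciprocity {c₀ ℓ₁ ℓ₂} (ℝ : RealField c₀ ℓ₁ ℓ₂) where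
  open Dedekind ℝ
  open RealArith ℝ
  open FiniteSums ℝ
  open Exponentials ℝ using (*-cancelˡ)
  open EulerBernoulli ℝ
  open ProductIdentities ℝ
  open Exponents
  open Solver using (_:+_; _:*_; _:-_; :-_; _:=_; solve; con)
  open SetoidReasoning setoid

  [-1]^-parity : ∀ n → 2 ∣ n ⊎ (- 1#) ^ n ≈ - 1#
  [-1]^-parity zero          = inj₁ (2 ∣0)
  [-1]^-parity (suc zero)    = inj₂ (*-identityʳ _)
  [-1]^-parity (suc (suc n)) with [-1]^-parity n
  ... | inj₁ even = inj₁ (∣m∣n⇒∣m+n ∣-refl even)
  ... | inj₂ odd  = inj₂ (trans (solve 1 (λ x → (:- con (+ 1)) :* ((:- con (+ 1)) :* x) := x) refl _) odd)

  -- Were a even, the even sum would make c even as well, and 2 would be a common divisor.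
  [-1]^-odd : ∀ a c → Coprime a c → 2 ∣ a ℕ.+ c → (- 1#) ^ a ≈ - 1#
  [-1]^-odd a c coprime 2∣a+c with [-1]^-parity a
  ... | inj₂ odd = odd
  ... | inj₁ 2∣a with coprime (2∣a , ∣m+n∣m⇒∣n 2∣a+c 2∣a)
  ...   | ()

  ^ℤ-cancel : ∀ n .{{_ : NonZero n}} i k j → i ℤ.+ + k ≡ j → fromℕ n ^ℤ i * fromℕ n ^ k ≈ fromℕ n ^ℤ j
  ^ℤ-cancel n i k j e = trans (sym (^ℤ-homo-* (fromℕ≉0 n) i (+ k))) (reflexive (≡.cong (fromℕ n ^ℤ_) e))

  -- The exponent i is -n, constrained by an equation so that the exponents of the theorem can be
  -- supplied as they stand.
  𝓔-distribution : ∀ a .{{_ : NonZero a}} → (- 1#) ^ a ≈ - 1# → ∀ n i → i ℤ.+ + n ≡ 0ℤ → ∀ u →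
    fromℕ a ^ℤ i * 𝓔 n u ≈ ∑< a λ l → (- 1#) ^ l * 𝓔 n ((u + fromℕ l) / fromℕ a)
  𝓔-distribution a odd n i e u = begin
    fromℕ a ^ℤ i * 𝓔 n u ≈⟨ *-congˡ (𝓔-multiplication a odd n u) ⟩
    fromℕ a ^ℤ i * (fromℕ a ^ n * s) ≈⟨ *-assoc _ _ _ ⟨
    fromℕ a ^ℤ i * fromℕ a ^ n * s ≈⟨ *-congʳ (^ℤ-cancel a i n 0ℤ e) ⟩
    1# * s ≈⟨ *-identityˡ s ⟩
    s ∎
    where
    s : Carrier
    s = ∑< a λ l → (- 1#) ^ l * 𝓔 n ((u + fromℕ l) / fromℕ a)

  𝓑-distribution : ∀ b .{{_ : NonZero b}} n i → i ℤ.+ + n ≡ + 1 → ∀ u →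
    fromℕ b ^ℤ i * 𝓑 n u ≈ ∑< b λ l → 𝓑 n ((u + fromℕ l) / fromℕ b)
  𝓑-distribution b n i e u = *-cancelˡ (fromℕ≉0 b) (begin
    fromℕ b * (fromℕ b ^ℤ i * 𝓑 n u) ≈⟨ solve 3 (λ x y z → x :* (y :* z) := y :* (x :* z)) refl _ _ _ ⟩
    fromℕ b ^ℤ i * (fromℕ b * 𝓑 n u) ≈⟨ *-congˡ (𝓑-multiplication b n u) ⟩
    fromℕ b ^ℤ i * (fromℕ b ^ n * s) ≈⟨ *-assoc _ _ _ ⟨
    fromℕ b ^ℤ i * fromℕ b ^ n * s   ≈⟨ *-congʳ (trans (^ℤ-cancel b i n (+ 1) e) (*-identityʳ _)) ⟩
    fromℕ b * s ∎)
    where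
    s : Carrier
    s = ∑< b λ l → 𝓑 n ((u + fromℕ l) / fromℕ b)

  scale-shift : ∀ {n} → ¬ (n ≈ 0#) → ∀ w x l → (n * w + x + l) / n ≈ (l + x) / n + w
  scale-shift {n} n≉0 w x l = begin
    (n * w + x + l) * n ⁻¹ ≈⟨ solve 5 (λ n w x l m → (n :* w :+ x :+ l) :* m := (l :+ x) :* m :+ n :* m :* w) refl n w x l (n ⁻¹) ⟩
    (l + x) / n + n * n ⁻¹ * w ≈⟨ +-congˡ (trans (*-congʳ (⁻¹-inverseʳ n≉0)) (*-identityˡ w)) ⟩
    (l + x) / n + w ∎

  fromℕ-∸ : ∀ {m n} → m ℕ.≤ n → fromℕ (n ∸ m) ≈ fromℕ n - fromℕ m
  fromℕ-∸ {m} {n} m≤n = trans (reflexive (≡.cong fromℤ (≡.sym (ℤ.⊖-≥ m≤n)))) (fromℤ-⊖ n m)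

  -- The nodes w - (l + y)/b descend in l. Period 1 allows the argument to be moved by -(b - 1),
  -- after which reversing the summation, l ↦ b - 1 - l, yields exactly these nodes.
  𝓑-distribution⁻ : ∀ b .{{_ : NonZero b}} n i → i ℤ.+ + n ≡ + 1 → ∀ w y →
    fromℕ b ^ℤ i * 𝓑 n (fromℕ b * w - y) ≈ ∑< b λ l → 𝓑 n (w - (fromℕ l + y) / fromℕ b)
  𝓑-distribution⁻ b n i e w y = begin
    b̂ ^ℤ i * 𝓑 n (b̂ * w - y)       ≈⟨ *-congˡ (𝓑-shift n (b̂ * w - y) (ℤ.- + (b ∸ 1))) ⟨
    b̂ ^ℤ i * 𝓑 n u                 ≈⟨ 𝓑-distribution b n i e u ⟩
    ∑< b (λ l → 𝓑 n ((u + fromℕ l) / b̂))           ≈⟨ ∑<-reverse b _ ⟩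
    ∑< b (λ l → 𝓑 n ((u + fromℕ (b ∸ suc l)) / b̂)) ≈⟨ ∑<-cong b (λ l l<b → 𝓑-cong n (argument l l<b)) ⟩
    ∑< b (λ l → 𝓑 n (w - (fromℕ l + y) / b̂))       ∎
    where
    b̂ u : Carrier
    b̂ = fromℕ b
    u = b̂ * w - y + fromℤ (ℤ.- + (b ∸ 1))
    argument : ∀ l → l ℕ.< b → (u + fromℕ (b ∸ suc l)) / b̂ ≈ w - (fromℕ l + y) / b̂
    argument l l<b = begin
      (b̂ * w - y + fromℤ (ℤ.- + (b ∸ 1)) + fromℕ (b ∸ suc l)) / b̂
        ≈⟨ *-congʳ (+-cong (+-congˡ (trans (fromℤ-homo-- (+ (b ∸ 1))) (-‿cong (fromℕ-∸ (ℕ.≤-trans (s≤s z≤n) l<b))))) (fromℕ-∸ l<b)) ⟩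
      (b̂ * w - y + - (b̂ - (1# + 0#)) + (b̂ - (1# + fromℕ l))) * b̂ ⁻¹
        ≈⟨ solve 5 (λ b w y l m → (b :* w :- y :+ :- (b :- (con (+ 1) :+ con (+ 0))) :+ (b :- (con (+ 1) :+ l))) :* m
             := b :* m :* w :- (l :+ y) :* m) refl b̂ w y (fromℕ l) (b̂ ⁻¹) ⟩
      b̂ * b̂ ⁻¹ * w - (fromℕ l + y) / b̂
        ≈⟨ +-congʳ (trans (*-congʳ (⁻¹-inverseʳ (fromℕ≉0 b))) (*-identityˡ w)) ⟩
      w - (fromℕ l + y) / b̂ ∎

  ∑<-product : ∀ m n x f g → x * ∑< m f * ∑< n g ≈ ∑< m λ i → ∑< n λ j → x * f i * g j
  ∑<-product m n x f g = begin
    x * ∑< m f * ∑< n g               ≈⟨ *-congʳ (∑<-*ˡ m x f) ⟩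
    ∑< m (λ i → x * f i) * ∑< n g     ≈⟨ ∑<-*ʳ m _ _ ⟩
    ∑< m (λ i → x * f i * ∑< n g)     ≈⟨ ∑<-cong′ m (λ i → ∑<-*ˡ n _ _) ⟩
    ∑< m (λ i → ∑< n (λ j → x * f i * g j)) ∎

  ∑[0⋯n∸1]≡∑< : ∀ n .{{_ : NonZero n}} f → ∑[ 0 ⋯ n ∸ 1 ] f ≡ ∑< n f
  ∑[0⋯n∸1]≡∑< (suc n) f = ∑[0⋯n]≡∑< n f

  ∑<-interchange : ∀ m n (κ : ℕ → Carrier) (G : ℕ → ℕ → Carrier) →
    ∑< m (λ j → κ j * ∑< n (G j)) ≈ ∑< n (λ i → ∑< m (λ j → κ j * G j i))
  ∑<-interchange m n κ G = trans (∑<-cong′ m λ j → ∑<-*ˡ n (κ j) (G j)) (∑<-comm m n _)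

  module _ (a b c : ℕ) .{{_ : NonZero a}} .{{_ : NonZero b}} .{{_ : NonZero c}}
           (a-odd : (- 1#) ^ a ≈ - 1#) (c-odd : (- 1#) ^ c ≈ - 1#) (x y z : Carrier) where

    private
      X Y Z : ℕ → Carrier
      X l = (fromℕ l + x) / fromℕ a
      Y n = (fromℕ n + y) / fromℕ b
      Z m = (fromℕ m + z) / fromℕ c

      sign : ℕ → ℕ → Carrier
      sign l m = (- 1#) ^ l * (- 1#) ^ m

      ∑³ : (ℕ → ℕ → ℕ → Carrier) → Carrier
      ∑³ F = ∑< a λ l → ∑< c λ m → ∑< b λ n → F l m n

    ∑³-cong : ∀ {F G} → (∀ l m n → F l m n ≈ G l m n) → ∑³ F ≈ ∑³ G
    ∑³-cong e = ∑<-cong′ a λ l → ∑<-cong′ c λ m → ∑<-cong′ b λ n → e l m n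

    ∑³-interchange : ∀ k (κ : ℕ → Carrier) (G : ℕ → ℕ → ℕ → ℕ → Carrier) →
      ∑< k (λ j → κ j * ∑³ (G j)) ≈ ∑³ λ l m n → ∑< k λ j → κ j * G j l m n
    ∑³-interchange k κ G = trans
      (∑<-interchange k a κ λ j l → ∑< c λ m → ∑< b λ n → G j l m n) (∑<-cong′ a λ l →
      trans (∑<-interchange k c κ λ j m → ∑< b λ n → G j l m n) (∑<-cong′ c λ m →
      ∑<-interchange k b κ λ j n → G j l m n))

    ∑³-*ˡ : ∀ w F → w * ∑³ F ≈ ∑³ λ l m n → w * F l m n
    ∑³-*ˡ w F = trans (∑<-*ˡ a w _) (∑<-cong′ a λ l → trans (∑<-*ˡ c w _) (∑<-cong′ c λ m → ∑<-*ˡ b w _))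

    ∑³-+ : ∀ F G → ∑³ (λ l m n → F l m n + G l m n) ≈ ∑³ F + ∑³ G
    ∑³-+ F G = trans (∑<-cong′ a λ l → trans (∑<-cong′ c λ m → ∑<-+ b _ _) (∑<-+ c _ _)) (∑<-+ a _ _)

    -- The sum's own index is m, with sign (-1)^m. The Euler factor expands over l and brings
    -- (-1)^l, the Bernoulli factor over n without sign.
    S³⁵-triple : ∀ p q i j → i ℤ.+ + (p ∸ 1) ≡ 0ℤ → j ℤ.+ + q ≡ + 1 →
      fromℕ a ^ℤ i * fromℕ b ^ℤ j * S³⁵ p q (+ a) (+ b) c x y z
        ≈ ∑³ λ l m n → sign l m * (𝓔 (p ∸ 1) (X l + Z m) * 𝓑 q (Y n + Z m))
    S³⁵-triple p q i j ei ej = begin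
      α * β * S³⁵ p q (+ a) (+ b) c x y z ≡⟨ ≡.cong (α * β *_) (∑[0⋯n∸1]≡∑< c _) ⟩
      α * β * ∑< c (λ m → (- 1#) ^ m * 𝓔 (p ∸ 1) (fromℕ a * Z m + x) * 𝓑 q (fromℕ b * Z m + y)) ≈⟨ ∑<-*ˡ c _ _ ⟩
      ∑< c (λ m → α * β * ((- 1#) ^ m * 𝓔 (p ∸ 1) (fromℕ a * Z m + x) * 𝓑 q (fromℕ b * Z m + y)))
        ≈⟨ ∑<-cong′ c (λ m → trans (solve 5 (λ α β s e b → α :* β :* (s :* e :* b) := s :* (α :* e) :* (β :* b)) refl _ _ _ _ _)
             (trans (*-cong (*-congˡ (𝓔-distribution a a-odd (p ∸ 1) i ei _)) (𝓑-distribution b q j ej _)) (∑<-product a b _ _ _))) ⟩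
      ∑< c (λ m → ∑< a λ l → ∑< b λ n → (- 1#) ^ m * ((- 1#) ^ l * 𝓔 (p ∸ 1) ((fromℕ a * Z m + x + fromℕ l) / fromℕ a))
          * 𝓑 q ((fromℕ b * Z m + y + fromℕ n) / fromℕ b)) ≈⟨ ∑<-comm c a _ ⟩
      ∑³ (λ l m n → (- 1#) ^ m * ((- 1#) ^ l * 𝓔 (p ∸ 1) ((fromℕ a * Z m + x + fromℕ l) / fromℕ a))
          * 𝓑 q ((fromℕ b * Z m + y + fromℕ n) / fromℕ b))
        ≈⟨ ∑³-cong (λ l m n → trans (*-cong (*-congˡ (*-congˡ (PE.𝓟-cong (p ∸ 1) (scale-shift (fromℕ≉0 a) (Z m) x (fromℕ l)))))
             (𝓑-cong q (scale-shift (fromℕ≉0 b) (Z m) y (fromℕ n))))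
             (solve 4 (λ s t e b → s :* (t :* e) :* b := t :* s :* (e :* b)) refl _ _ _ _)) ⟩
      ∑³ (λ l m n → sign l m * (𝓔 (p ∸ 1) (X l + Z m) * 𝓑 q (Y n + Z m))) ∎
      where
      α β : Carrier
      α = fromℕ a ^ℤ i
      β = fromℕ b ^ℤ j

    -- The own index n carries no sign here; both signs come from the Euler factors. The parameter
    -- -a produces the difference X - Y.
    S⁴-triple : ∀ p q i j → i ℤ.+ + (q ∸ 1) ≡ 0ℤ → j ℤ.+ + (p ∸ 1) ≡ 0ℤ →
      fromℕ a ^ℤ i * fromℕ c ^ℤ j * S⁴ p q (+ c) (ℤ.- + a) b z x y
        ≈ ∑³ λ l m n → sign l m * (𝓔 (q ∸ 1) (X l - Y n) * 𝓔 (p ∸ 1) (Y n + Z m))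
    S⁴-triple p q i j ei ej = begin
      α * γ * S⁴ p q (+ c) (ℤ.- + a) b z x y ≡⟨ ≡.cong (α * γ *_) (∑[0⋯n∸1]≡∑< b _) ⟩
      α * γ * ∑< b (λ n → 𝓔 (p ∸ 1) (fromℕ c * Y n + z) * 𝓔 (q ∸ 1) (fromℤ (ℤ.- + a) * Y n + x)) ≈⟨ ∑<-*ˡ b _ _ ⟩
      ∑< b (λ n → α * γ * (𝓔 (p ∸ 1) (fromℕ c * Y n + z) * 𝓔 (q ∸ 1) (fromℤ (ℤ.- + a) * Y n + x)))
        ≈⟨ ∑<-cong′ b (λ n → trans (solve 4 (λ α γ e f → α :* γ :* (e :* f) := con (+ 1) :* (α :* f) :* (γ :* e)) refl _ _ _ _)
             (trans (*-cong (*-congˡ (𝓔-distribution a a-odd (q ∸ 1) i ei _)) (𝓔-distribution c c-odd (p ∸ 1) j ej _)) (∑<-product a c _ _ _))) ⟩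
      ∑< b (λ n → ∑< a λ l → ∑< c λ m → 1# * ((- 1#) ^ l * 𝓔 (q ∸ 1) ((fromℤ (ℤ.- + a) * Y n + x + fromℕ l) / fromℕ a))
          * ((- 1#) ^ m * 𝓔 (p ∸ 1) ((fromℕ c * Y n + z + fromℕ m) / fromℕ c))) ≈⟨ ∑<-comm b a _ ⟩
      ∑< a (λ l → ∑< b λ n → ∑< c λ m → 1# * ((- 1#) ^ l * 𝓔 (q ∸ 1) ((fromℤ (ℤ.- + a) * Y n + x + fromℕ l) / fromℕ a))
          * ((- 1#) ^ m * 𝓔 (p ∸ 1) ((fromℕ c * Y n + z + fromℕ m) / fromℕ c))) ≈⟨ ∑<-cong′ a (λ l → ∑<-comm b c _) ⟩
      ∑³ (λ l m n → 1# * ((- 1#) ^ l * 𝓔 (q ∸ 1) ((fromℤ (ℤ.- + a) * Y n + x + fromℕ l) / fromℕ a))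
          * ((- 1#) ^ m * 𝓔 (p ∸ 1) ((fromℕ c * Y n + z + fromℕ m) / fromℕ c)))
        ≈⟨ ∑³-cong (λ l m n → trans (*-cong (*-congˡ (*-congˡ (PE.𝓟-cong (q ∸ 1) (negative l n))))
             (*-congˡ (PE.𝓟-cong (p ∸ 1) (trans (scale-shift (fromℕ≉0 c) (Y n) z (fromℕ m)) (+-comm _ _)))))
             (solve 4 (λ s t e f → con (+ 1) :* (s :* e) :* (t :* f) := s :* t :* (e :* f)) refl _ _ _ _)) ⟩
      ∑³ (λ l m n → sign l m * (𝓔 (q ∸ 1) (X l - Y n) * 𝓔 (p ∸ 1) (Y n + Z m))) ∎
      where
      α γ : Carrier
      α = fromℕ a ^ℤ i
      γ = fromℕ c ^ℤ j
      negative : ∀ l n → (fromℤ (ℤ.- + a) * Y n + x + fromℕ l) / fromℕ a ≈ X l - Y n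
      negative l n = begin
        (fromℤ (ℤ.- + a) * Y n + x + fromℕ l) / fromℕ a
          ≈⟨ *-congʳ (+-congʳ (+-congʳ (trans (*-congʳ (fromℤ-homo-- (+ a))) (solve 2 (λ a y → :- a :* y := a :* :- y) refl (fromℕ a) (Y n))))) ⟩
        (fromℕ a * - Y n + x + fromℕ l) / fromℕ a ≈⟨ scale-shift (fromℕ≉0 a) (- Y n) x (fromℕ l) ⟩
        X l - Y n ∎

    -- The own index is l. Since y enters negated, the Bernoulli factor is expanded along descending
    -- nodes, which again gives X - Y.
    S³⁵-triple′ : ∀ p q i j → i ℤ.+ + q ≡ + 1 → j ℤ.+ + (p ∸ 1) ≡ 0ℤ →
      fromℕ b ^ℤ i * fromℕ c ^ℤ j * S³⁵ p q (+ c) (+ b) a z (- y) x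
        ≈ ∑³ λ l m n → sign l m * (𝓑 q (X l - Y n) * 𝓔 (p ∸ 1) (X l + Z m))
    S³⁵-triple′ p q i j ei ej = begin
      β * γ * S³⁵ p q (+ c) (+ b) a z (- y) x ≡⟨ ≡.cong (β * γ *_) (∑[0⋯n∸1]≡∑< a _) ⟩
      β * γ * ∑< a (λ l → (- 1#) ^ l * 𝓔 (p ∸ 1) (fromℕ c * X l + z) * 𝓑 q (fromℕ b * X l - y)) ≈⟨ ∑<-*ˡ a _ _ ⟩
      ∑< a (λ l → β * γ * ((- 1#) ^ l * 𝓔 (p ∸ 1) (fromℕ c * X l + z) * 𝓑 q (fromℕ b * X l - y)))
        ≈⟨ ∑<-cong′ a (λ l → trans (solve 5 (λ β γ s e b → β :* γ :* (s :* e :* b) := s :* (γ :* e) :* (β :* b)) refl _ _ _ _ _)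
             (trans (*-cong (*-congˡ (𝓔-distribution c c-odd (p ∸ 1) j ej _)) (𝓑-distribution⁻ b q i ei (X l) y)) (∑<-product c b _ _ _))) ⟩
      ∑³ (λ l m n → (- 1#) ^ l * ((- 1#) ^ m * 𝓔 (p ∸ 1) ((fromℕ c * X l + z + fromℕ m) / fromℕ c)) * 𝓑 q (X l - Y n))
        ≈⟨ ∑³-cong (λ l m n → trans (*-congʳ (*-congˡ (*-congˡ (PE.𝓟-cong (p ∸ 1)
             (trans (scale-shift (fromℕ≉0 c) (X l) z (fromℕ m)) (+-comm _ _))))))
             (solve 4 (λ s t e b → s :* (t :* e) :* b := s :* t :* (b :* e)) refl _ _ _ _)) ⟩
      ∑³ (λ l m n → sign l m * (𝓑 q (X l - Y n) * 𝓔 (p ∸ 1) (X l + Z m))) ∎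
      where
      β γ : Carrier
      β = fromℕ b ^ℤ i
      γ = fromℕ c ^ℤ j

    reciprocity : (p q : ℕ) .{{_ : NonZero p}} .{{_ : NonZero q}} →
      fromℕ a ^ℤ (+ 1 ℤ.- + p) * fromℕ b ^ℤ (+ 1 ℤ.- + q) * S³⁵ p q (+ a) (+ b) c x y z
        ≈ - (fromℕ q / fromℕ 2)
            * ∑[ 1 ⋯ p ] (λ j →
                fromℕ ((p ∸ 1) C (j ∸ 1)) * fromℕ a ^ℤ (+ 1 ℤ.- + j)
                  * fromℕ c ^ℤ (+ 1 ℤ.+ + j ℤ.- + p ℤ.- + q)
                  * S⁴ (p ℕ.+ q ∸ j) j (+ c) (ℤ.- + a) b z x y)
          + ∑[ 0 ⋯ q ] (λ h →
                fromℕ (q C h) * (- 1#) ^ h * fromℕ b ^ℤ (+ 1 ℤ.- + h)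
                  * fromℕ c ^ℤ (+ 1 ℤ.+ + h ℤ.- + p ℤ.- + q)
                  * S³⁵ (p ℕ.+ q ∸ h) h (+ c) (+ b) a z (- y) x)
    reciprocity (suc p) (suc q) = begin
      fromℕ a ^ℤ (+ 1 ℤ.- + suc p) * fromℕ b ^ℤ (+ 1 ℤ.- + suc q) * S³⁵ (suc p) (suc q) (+ a) (+ b) c x y z
        ≈⟨ S³⁵-triple (suc p) (suc q) (+ 1 ℤ.- + suc p) (+ 1 ℤ.- + suc q) (1-[1+j]+j≡0 p) (1-j+j≡1 (suc q)) ⟩
      ∑³ (λ l m n → sign l m * (𝓔 p (X l + Z m) * 𝓑 (suc q) (Y n + Z m))) ≈⟨ ∑³-cong termwise ⟩
      ∑³ (λ l m n → w * (sign l m * cU l m n) + sign l m * cV l m n) ≈⟨ ∑³-+ _ _ ⟩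
      ∑³ (λ l m n → w * (sign l m * cU l m n)) + ∑³ (λ l m n → sign l m * cV l m n)
        ≈⟨ +-cong (trans (sym (∑³-*ˡ w _)) (*-congˡ (sym first))) (sym second) ⟩
      w * ∑[ 1 ⋯ suc p ] term₁ + ∑[ 0 ⋯ suc q ] term₂ ∎
      where
      w : Carrier
      w = - (fromℕ (suc q) / fromℕ 2)

      term₁ term₂ : ℕ → Carrier
      term₁ j = fromℕ (p C (j ∸ 1)) * fromℕ a ^ℤ (+ 1 ℤ.- + j)
        * fromℕ c ^ℤ (+ 1 ℤ.+ + j ℤ.- + suc p ℤ.- + suc q)
        * S⁴ (suc p ℕ.+ suc q ∸ j) j (+ c) (ℤ.- + a) b z x y
      term₂ h = fromℕ (suc q C h) * (- 1#) ^ h * fromℕ b ^ℤ (+ 1 ℤ.- + h)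
        * fromℕ c ^ℤ (+ 1 ℤ.+ + h ℤ.- + suc p ℤ.- + suc q)
        * S³⁵ (suc p ℕ.+ suc q ∸ h) h (+ c) (+ b) a z (- y) x

      cU cV : ℕ → ℕ → ℕ → Carrier
      cU l m n = convU p (suc q) (λ j → 𝓔 j (X l - Y n)) (λ j → 𝓔 j (Y n + Z m))
      cV l m n = convV p (suc q) (λ j → 𝓑 j (X l - Y n)) (λ j → 𝓔 j (X l + Z m))

      termwise : ∀ l m n → sign l m * (𝓔 p (X l + Z m) * 𝓑 (suc q) (Y n + Z m))
        ≈ w * (sign l m * cU l m n) + sign l m * cV l m n
      termwise l m n = trans (*-congˡ product) (solve 4 (λ s w u v → s :* (w :* u :+ v) := w :* (s :* u) :+ s :* v) refl _ _ _ _)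
        where
        r+t : X l - Y n + (Y n + Z m) ≈ X l + Z m
        r+t = solve 3 (λ x y z → x :- y :+ (y :+ z) := x :+ z) refl _ _ _
        identity : fromℕ 2 * (𝓔 p (X l + Z m) * 𝓑 (suc q) (Y n + Z m)) + fromℕ (suc q) * cU l m n ≈ fromℕ 2 * cV l m n
        identity = trans (+-congʳ (*-congˡ (*-congʳ (PE.𝓟-cong p (sym r+t)))))
          (trans (𝓔𝓑-product p (suc q) (X l - Y n) (Y n + Z m))
            (*-congˡ (∑<-cong′ (suc (suc q)) λ h → *-congˡ (*-congˡ (PE.𝓟-cong (p ℕ.+ (suc q ∸ h)) r+t)))))
        product : 𝓔 p (X l + Z m) * 𝓑 (suc q) (Y n + Z m) ≈ w * cU l m n + cV l m n
        product = *-cancelˡ (fromℕ≉0 2) (begin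
          fromℕ 2 * (𝓔 p (X l + Z m) * 𝓑 (suc q) (Y n + Z m))
            ≈⟨ solve 2 (λ L U → L := :- U :+ (L :+ U)) refl _ (fromℕ (suc q) * cU l m n) ⟩
          - (fromℕ (suc q) * cU l m n) + (fromℕ 2 * (𝓔 p (X l + Z m) * 𝓑 (suc q) (Y n + Z m)) + fromℕ (suc q) * cU l m n)
            -- Writing q as 2 (q/2) exposes a common factor 2, which is cancelled at the end.
            ≈⟨ +-cong (-‿cong (*-congʳ (sym (/-cancelˡ (fromℕ≉0 2) (fromℕ (suc q)))))) identity ⟩
          - (fromℕ 2 * (fromℕ (suc q) / fromℕ 2) * cU l m n) + fromℕ 2 * cV l m n
            ≈⟨ solve 4 (λ t q u v → :- (t :* q :* u) :+ t :* v := t :* (:- q :* u :+ v)) refl _ _ _ _ ⟩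
          fromℕ 2 * (w * cU l m n + cV l m n) ∎)

      first : ∑[ 1 ⋯ suc p ] term₁ ≈ ∑³ λ l m n → sign l m * cU l m n
      first = begin
        ∑[ 1 ⋯ suc p ] term₁ ≡⟨ ∑[1⋯n]≡∑< (suc p) term₁ ⟩
        ∑< (suc p) (λ j → term₁ (suc j))
          ≈⟨ ∑<-cong (suc p) (λ { j (s≤s j≤p) → trans (solve 4 (λ k a c s → k :* a :* c :* s := k :* (a :* c :* s)) refl _ _ _ _)
               (*-congˡ (S⁴-triple (p ℕ.+ suc q ∸ j) (suc j) (+ 1 ℤ.- + suc j) (+ 1 ℤ.+ + suc j ℤ.- + suc p ℤ.- + suc q) (1-[1+j]+j≡0 j)
                 (1+h-p-q+k≡0 p q (suc j) (p ℕ.+ suc q ∸ j ∸ 1) (≡.cong suc (≡.trans (≡.cong (j ℕ.+_) (index j≤p)) (recombine j≤p)))))) }) ⟩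
        ∑< (suc p) (λ j → fromℕ (p C j) * ∑³ λ l m n → sign l m * (𝓔 j (X l - Y n) * 𝓔 (p ℕ.+ suc q ∸ j ∸ 1) (Y n + Z m)))
          ≈⟨ ∑³-interchange (suc p) _ (λ j l m n → sign l m * (𝓔 j (X l - Y n) * 𝓔 (p ℕ.+ suc q ∸ j ∸ 1) (Y n + Z m))) ⟩
        ∑³ (λ l m n → ∑< (suc p) λ j → fromℕ (p C j) * (sign l m * (𝓔 j (X l - Y n) * 𝓔 (p ℕ.+ suc q ∸ j ∸ 1) (Y n + Z m))))
          ≈⟨ ∑³-cong (λ l m n → trans (∑<-cong (suc p) λ { j (s≤s j≤p) →
               trans (solve 3 (λ k s e → k :* (s :* e) := s :* (k :* e)) refl _ _ _)
                 (*-congˡ (*-congˡ (*-congˡ (reflexive (≡.cong (λ i → 𝓔 i (Y n + Z m)) (index j≤p)))))) })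
               (sym (∑<-*ˡ (suc p) _ _))) ⟩
        ∑³ (λ l m n → sign l m * cU l m n) ∎
        where
        -- With j ≤ p every truncated subtraction is a true one. The index j is one less than in the
        -- theorem, so the Euler indices add up to p + q, which fixes the exponent of c.
        index : ∀ {j} → j ℕ.≤ p → p ℕ.+ suc q ∸ j ∸ 1 ≡ p ∸ j ℕ.+ q
        index {j} j≤p = ≡.trans (≡.cong (λ i → i ∸ j ∸ 1) (ℕ.+-suc p q))
          (≡.trans (≡.cong (_∸ 1) (ℕ.+-∸-assoc 1 (ℕ.≤-trans j≤p (ℕ.m≤m+n p q)))) (ℕ.+-∸-comm q j≤p))
        recombine : ∀ {j} → j ℕ.≤ p → j ℕ.+ (p ∸ j ℕ.+ q) ≡ p ℕ.+ q
        recombine {j} j≤p = ≡.trans (≡.sym (ℕ.+-assoc j (p ∸ j) q)) (≡.cong (ℕ._+ q) (ℕ.m+[n∸m]≡n j≤p))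

      second : ∑[ 0 ⋯ suc q ] term₂ ≈ ∑³ λ l m n → sign l m * cV l m n
      second = begin
        ∑[ 0 ⋯ suc q ] term₂ ≡⟨ ∑[0⋯n]≡∑< (suc q) term₂ ⟩
        ∑< (suc (suc q)) term₂
          ≈⟨ ∑<-cong (suc (suc q)) (λ { h (s≤s h≤q) → trans (solve 4 (λ k b c s → k :* b :* c :* s := k :* (b :* c :* s)) refl _ _ _ _)
               (*-congˡ (S³⁵-triple′ (suc p ℕ.+ suc q ∸ h) h (+ 1 ℤ.- + h) (+ 1 ℤ.+ + h ℤ.- + suc p ℤ.- + suc q) (1-j+j≡1 h)
                 (1+h-p-q+k≡0 p q h (suc p ℕ.+ suc q ∸ h ∸ 1) (≡.trans (≡.cong (h ℕ.+_) (index h≤q)) (recombine h≤q))))) }) ⟩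
        ∑< (suc (suc q)) (λ h → fromℕ (suc q C h) * (- 1#) ^ h * ∑³ λ l m n → sign l m * (𝓑 h (X l - Y n) * 𝓔 (suc p ℕ.+ suc q ∸ h ∸ 1) (X l + Z m)))
          ≈⟨ ∑³-interchange (suc (suc q)) _ (λ h l m n → sign l m * (𝓑 h (X l - Y n) * 𝓔 (suc p ℕ.+ suc q ∸ h ∸ 1) (X l + Z m))) ⟩
        ∑³ (λ l m n → ∑< (suc (suc q)) λ h → fromℕ (suc q C h) * (- 1#) ^ h * (sign l m * (𝓑 h (X l - Y n) * 𝓔 (suc p ℕ.+ suc q ∸ h ∸ 1) (X l + Z m))))
          ≈⟨ ∑³-cong (λ l m n → trans (∑<-cong (suc (suc q)) λ { h (s≤s h≤q) →
               trans (solve 5 (λ k g s b e → k :* g :* (s :* (b :* e)) := s :* (k :* (g :* b :* e))) refl _ _ _ _ _)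
                 (*-congˡ (*-congˡ (*-congˡ (reflexive (≡.cong (λ i → 𝓔 i (X l + Z m)) (index h≤q)))))) })
               (sym (∑<-*ˡ (suc (suc q)) _ _))) ⟩
        ∑³ (λ l m n → sign l m * cV l m n) ∎
        where
        index : ∀ {h} → h ℕ.≤ suc q → suc p ℕ.+ suc q ∸ h ∸ 1 ≡ p ℕ.+ (suc q ∸ h)
        index {h} h≤q = ≡.cong (_∸ 1) (ℕ.+-∸-assoc (suc p) h≤q)
        recombine : ∀ {h} → h ℕ.≤ suc q → h ℕ.+ (p ℕ.+ (suc q ∸ h)) ≡ suc (p ℕ.+ q)
        recombine {h} h≤q = ≡.trans (ℕ.+-comm h _) (≡.trans (ℕ.+-assoc p (suc q ∸ h) h)
          (≡.trans (≡.cong (p ℕ.+_) (ℕ.m∸n+n≡m h≤q)) (ℕ.+-suc p q)))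

theorem5 : ∀ {c₀ ℓ₁ ℓ₂} (ℝ : RealField c₀ ℓ₁ ℓ₂) → let open Dedekind ℝ in
    (a b c : ℕ) .{{_ : NonZero a}} .{{_ : NonZero b}} .{{_ : NonZero c}} →
    Coprime a b → Coprime a c → Coprime b c → 2 ∣ a ℕ.+ c →
    (p q : ℕ) .{{_ : NonZero p}} .{{_ : NonZero q}} (x y z : Carrier) →
    fromℕ a ^ℤ (+ 1 ℤ.- + p) * fromℕ b ^ℤ (+ 1 ℤ.- + q) * S³⁵ p q (+ a) (+ b) c x y z
    ≈ - (fromℕ q / fromℕ 2)
    * ∑[ 1 ⋯ p ] (λ j →
    fromℕ ((p ∸ 1) C (j ∸ 1)) * fromℕ a ^ℤ (+ 1 ℤ.- + j)
    * fromℕ c ^ℤ (+ 1 ℤ.+ + j ℤ.- + p ℤ.- + q)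
    * S⁴ (p ℕ.+ q ∸ j) j (+ c) (ℤ.- + a) b z x y)
    + ∑[ 0 ⋯ q ] (λ h →
    fromℕ (q C h) * (- 1#) ^ h * fromℕ b ^ℤ (+ 1 ℤ.- + h)
    * fromℕ c ^ℤ (+ 1 ℤ.+ + h ℤ.- + p ℤ.- + q)
    * S³⁵ (p ℕ.+ q ∸ h) h (+ c) (+ b) a z (- y) x)
theorem5 ℝ a b c _ a⊥c _ 2∣a+c p q x y z =
  reciprocity a b c ([-1]^-odd a c a⊥c 2∣a+c) ([-1]^-odd c a c⊥a 2∣c+a) x y z p q
  where
  open Reciprocity ℝ
  c⊥a : Coprime c a
  c⊥a (i , j) = a⊥c (j , i)
  2∣c+a : 2 ∣ c ℕ.+ a
  2∣c+a = ≡.subst (2 ∣_) (ℕ.+-comm a c) 2∣a+c
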